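{- For all positive integers $m,n$, let $K_2(m,n):=\max_{A\in\mathcal A(m,n)}\mathrm{Vdisc}_2(A)$. Then $$K_2(m,n)\le \max_{C\in\mathcal C(m,n)}\mathrm{cdisc}(C)\le 2\,K_2(2m,n).$$
   Context: $\mathcal A(m,n)$ is the set of matrices in $\mathbb R^{m\times n}$ all of whose columns have Euclidean norm at most $1$ (real Koml\'os matrices); $\mathcal C(m,n)$ is the set of matrices in $\mathbb C^{m\times n}$ all of whose columns have $\ell_2$ norm at most $1$ (complex Koml\'os matrices). For $C\in\mathbb C^{m\times n}$, $\mathrm{cdisc}(C):=\min_{z\in\mathbb T^n}\|Cz\|_\infty$, where $\mathbb T^n$ is the set of vectors in $\mathbb C^n$ all of whose entries have modulus $1$ and $\|w\|_\infty=\max_i|w_i|$. For $A\in\mathbb R^{m\times n}$, the rank-2 vector discrepancy is $\mathrm{Vdisc}_2(A):=\min_{u_1,\dots,u_n\in\mathbb S^1}\max_{1\le i\le m}\big|\sum_{j=1}^n A_{ij}u_j\big|$, where $\mathbb S^1$ is the unit circle in $\mathbb R^2$ and $|\cdot|$ is the Euclidean norm on $\mathbb R^2$. -}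

module Defs where

open import Level using (_⊔_; Lift; lift) renaming (suc to lsuc)
open import Data.Nat.Base using (ℕ)
open import Data.Fin.Base using (Fin)
open import Data.Product using (∃; ∃-syntax; _×_; _,_; proj₁)
open import Data.Sum using (_⊎_; inj₁; inj₂)
open import Data.Vec.Functional using (Vector; foldr)
open import Relation.Nullary using (¬_)
open import Relation.Unary using (Pred)
open import Relation.Binary using (Rel; IsDecTotalOrder; TotalOrder)
open import Algebra.Core using (Op₁; Op₂)
open import Algebra.Structures using (IsCommutativeRing)
open import Algebra.Bundles using (CommutativeRing)
open import Algebra.Bundles.Raw using (RawMonoid)
import Algebra.Definitions.RawMonoid as Sum
import Algebra.Construct.NaturalChoice.Max as Max
import Algebra.Properties.Ring as RingProperties

-- The real numbers, axiomatised up to isomorphism as a Dedekind-complete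
-- ordered field.  The order is decidable, as it is classically.
record CompleteOrderedField c ℓ₁ ℓ₂ : Set (lsuc (c ⊔ ℓ₁ ⊔ ℓ₂)) where
  infix  8 -_
  infixl 7 _*_
  infixl 6 _+_
  infix  4 _≈_ _≤_
  field
    Carrier : Set c
    _≈_     : Rel Carrier ℓ₁
    _≤_     : Rel Carrier ℓ₂
    _+_     : Op₂ Carrier
    _*_     : Op₂ Carrier
    -_      : Op₁ Carrier
    0#      : Carrier
    1#      : Carrier

    isCommutativeRing : IsCommutativeRing _≈_ _+_ _*_ -_ 0# 1#
    0≉1               : ¬ (0# ≈ 1#)
    inverse           : ∀ x → ¬ (x ≈ 0#) → ∃[ y ] x * y ≈ 1#

    isDecTotalOrder   : IsDecTotalOrder _≈_ _≤_
    +-monoˡ-≤         : ∀ z {x y} → x ≤ y → x + z ≤ y + z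
    *-nonNeg          : ∀ {x y} → 0# ≤ x → 0# ≤ y → 0# ≤ x * y

  IsUpperBound : ∀ {p} → Pred Carrier p → Pred Carrier (c ⊔ ℓ₂ ⊔ p)
  IsUpperBound P b = ∀ x → P x → x ≤ b

  IsLeastUpperBound : ∀ {p} → Pred Carrier p → Pred Carrier (c ⊔ ℓ₂ ⊔ p)
  IsLeastUpperBound P s = IsUpperBound P s × (∀ b → IsUpperBound P b → s ≤ b)

  field
    complete : (P : Pred Carrier (c ⊔ ℓ₁ ⊔ ℓ₂)) →
               ∃ P → ∃ (IsUpperBound P) → ∃ (IsLeastUpperBound P)

module Komlós {c ℓ₁ ℓ₂} (R : CompleteOrderedField c ℓ₁ ℓ₂) where

  open CompleteOrderedField R
  open IsDecTotalOrder isDecTotalOrder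
    using (isTotalOrder; total; ≤-respˡ-≈; ≤-respʳ-≈)
    renaming (refl to ≤-refl; trans to ≤-trans)

  commutativeRing : CommutativeRing c ℓ₁
  commutativeRing = record { isCommutativeRing = isCommutativeRing }

  totalOrder : TotalOrder c ℓ₁ ℓ₂
  totalOrder = record { isTotalOrder = isTotalOrder }

  private
    module CR = CommutativeRing commutativeRing
    module RP = RingProperties CR.ring

  open Max totalOrder using (x≤x⊔y; x≤y⊔x) renaming (_⊔_ to max)
  open Sum CR.+-rawMonoid using (sum)

  x≤y⇒0≤y-x : ∀ {x y} → x ≤ y → 0# ≤ y + - x
  x≤y⇒0≤y-x {x} x≤y = ≤-respˡ-≈ (CR.-‿inverseʳ x) (+-monoˡ-≤ (- x) x≤y)

  0≤y-x⇒x≤y : ∀ {x y} → 0# ≤ y + - x → x ≤ y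
  0≤y-x⇒x≤y {x} {y} p =
    ≤-respˡ-≈ (CR.+-identityˡ x)
      (≤-respʳ-≈ (CR.trans (CR.+-assoc y (- x) x)
                   (CR.trans (CR.+-congˡ (CR.-‿inverseˡ x)) (CR.+-identityʳ y)))
        (+-monoˡ-≤ x p))

  0≤1 : 0# ≤ 1#
  0≤1 with total 0# 1#
  ... | inj₁ p = p
  ... | inj₂ q = ≤-respʳ-≈ -1*-1≈1 (*-nonNeg 0≤-1 0≤-1)
    where
    0≤-1 : 0# ≤ - 1#
    0≤-1 = ≤-respʳ-≈ (CR.+-identityˡ (- 1#)) (x≤y⇒0≤y-x q)
    -1*-1≈1 : - 1# * - 1# ≈ 1#
    -1*-1≈1 = CR.trans (RP.-1*x≈-x (- 1#)) (RP.-‿involutive 1#)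

  1≤y⇒y≤y² : ∀ {y} → 1# ≤ y → y ≤ y * y
  1≤y⇒y≤y² {y} 1≤y = 0≤y-x⇒x≤y
    (≤-respʳ-≈ (CR.trans (CR.distribˡ y y (- 1#))
                 (CR.+-congˡ (CR.trans (CR.sym (RP.-‿distribʳ-* y 1#))
                                       (CR.-‿cong (CR.*-identityʳ y)))))
      (*-nonNeg (≤-trans 0≤1 1≤y) (x≤y⇒0≤y-x 1≤y)))

  -- The first disjunct makes the set nonempty for every x, so that √ is total;
  -- it does not change the supremum when 0 ≤ x, and √ x ≈ 0 when x < 0.
  SqrtSet : Carrier → Pred Carrier ℓ₂
  SqrtSet x y = y ≤ 0# ⊎ y * y ≤ x

  √-lub : ∀ x → ∃ (IsLeastUpperBound (SqrtSet x))
  √-lub x = let s , ub , least = complete P (0# , lift (inj₁ ≤-refl)) (b , bounded)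
            in s , (λ y y∈ → ub y (lift y∈)) ,
               (λ u u-ub → least u (λ { y (lift y∈) → u-ub y y∈ }))
    where
    P : Pred Carrier (c ⊔ ℓ₁ ⊔ ℓ₂)
    P y = Lift (c ⊔ ℓ₁ ⊔ ℓ₂) (SqrtSet x y)
    b = max 1# x
    1≤b : 1# ≤ b
    1≤b = x≤x⊔y 1# x
    x≤b : x ≤ b
    x≤b = x≤y⊔x 1# x
    bounded : IsUpperBound P b
    bounded y (lift (inj₁ y≤0)) = ≤-trans y≤0 (≤-trans 0≤1 1≤b)
    bounded y (lift (inj₂ y²≤x)) with total y 1#
    ... | inj₁ y≤1 = ≤-trans y≤1 1≤b
    ... | inj₂ 1≤y = ≤-trans (1≤y⇒y≤y² 1≤y) (≤-trans y²≤x x≤b)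

  √_ : Op₁ Carrier
  √ x = proj₁ (√-lub x)

  Matrix : ∀ {a} → Set a → ℕ → ℕ → Set a
  Matrix A m n = Fin m → Fin n → A

  -- The entries to which this is applied are nonnegative, so starting the
  -- fold at 0# gives their maximum whenever there is at least one of them.
  maximum : ∀ {n} → Vector Carrier n → Carrier
  maximum = foldr max 0#

  ‖_‖₂ : ∀ {n} → Vector Carrier n → Carrier
  ‖ v ‖₂ = √ sum (λ i → v i * v i)

  record ℂ : Set c where
    constructor _+i_
    field
      re : Carrier
      im : Carrier

  open ℂ public

  infixl 6 _+ᶜ_
  infixl 7 _*ᶜ_

  _+ᶜ_ : Op₂ ℂ
  w +ᶜ z = (re w + re z) +i (im w + im z)

  _*ᶜ_ : Op₂ ℂ
  w *ᶜ z = (re w * re z + - (im w * im z)) +i (re w * im z + im w * re z)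

  0ᶜ : ℂ
  0ᶜ = 0# +i 0#

  sumᶜ : ∀ {n} → Vector ℂ n → ℂ
  sumᶜ = foldr _+ᶜ_ 0ᶜ

  ∣_∣ : ℂ → Carrier
  ∣ z ∣ = √ (re z * re z + im z * im z)

  _·ᶜ_ : ∀ {m n} → Matrix ℂ m n → Vector ℂ n → Vector ℂ m
  (C ·ᶜ z) i = sumᶜ (λ j → C i j *ᶜ z j)

  ‖_‖∞ : ∀ {n} → Vector ℂ n → Carrier
  ‖ w ‖∞ = maximum (λ i → ∣ w i ∣)

  IsMin : ∀ {x p} {X : Set x} → Pred X p → (X → Carrier) →
          Pred Carrier (x ⊔ p ⊔ ℓ₁ ⊔ ℓ₂)
  IsMin P f v = (∃[ x ] P x × f x ≈ v) × (∀ x → P x → v ≤ f x)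

  -- Here the quantity maximised over P is a relation F, where F x v says that
  -- its value at x is v.  It is required to have a value at every x in P.
  IsMax : ∀ {x p q} {X : Set x} → Pred X p → (X → Pred Carrier q) →
          Pred Carrier (c ⊔ x ⊔ p ⊔ q ⊔ ℓ₂)
  IsMax P F v = (∃[ x ] P x × F x v) ×
                (∀ x → P x → ∃[ w ] F x w × w ≤ v)

  𝒜 : ∀ m n → Pred (Matrix Carrier m n) ℓ₂
  𝒜 m n A = ∀ j → ‖ (λ i → A i j) ‖₂ ≤ 1#

  𝒞 : ∀ m n → Pred (Matrix ℂ m n) ℓ₂
  𝒞 m n C = ∀ j → ‖ (λ i → ∣ C i j ∣) ‖₂ ≤ 1#

  𝕋 : ∀ n → Pred (Vector ℂ n) ℓ₁
  𝕋 n z = ∀ j → ∣ z j ∣ ≈ 1#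

  𝕊¹ : Pred (Vector Carrier 2) ℓ₁
  𝕊¹ u = ‖ u ‖₂ ≈ 1#

  IsCdisc : ∀ {m n} → Matrix ℂ m n → Pred Carrier (c ⊔ ℓ₁ ⊔ ℓ₂)
  IsCdisc {n = n} C = IsMin (𝕋 n) (λ z → ‖ C ·ᶜ z ‖∞)

  IsVdisc₂ : ∀ {m n} → Matrix Carrier m n → Pred Carrier (c ⊔ ℓ₁ ⊔ ℓ₂)
  IsVdisc₂ {n = n} A =
    IsMin {X = Fin n → Vector Carrier 2} (λ u → ∀ j → 𝕊¹ (u j))
      (λ u → maximum (λ i → ‖ (λ k → sum (λ j → A i j * u j k)) ‖₂))

  IsK₂ : ℕ → ℕ → Pred Carrier (c ⊔ ℓ₁ ⊔ ℓ₂)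
  IsK₂ m n = IsMax (𝒜 m n) IsVdisc₂

  IsMaxCdisc : ℕ → ℕ → Pred Carrier (c ⊔ ℓ₁ ⊔ ℓ₂)
  IsMaxCdisc m n = IsMax (𝒞 m n) IsCdisc

-- Over a real matrix, cdisc and Vdisc₂ coincide once ℂ is identified with ℝ²,
-- which gives the first inequality.  For the second, write C = X + iY: if z is
-- optimal for the stacked matrix [X; Y], then |Cz|² ≤ 2 (|Xz|² + |Yz|²) in each
-- row, and this is at most (2 K₂(2m,n))².
--
-- Most of the work is to show that the extrema are attained, with witnesses and
-- without excluded middle.  A space is called compact when every Lipschitz
-- function on it has a maximiser.  This holds for [-1, 1], by taking a supremum,
-- and passes to products and to sets {h ≤ 0} with h Lipschitz, hence to circles
-- and balls.  The partial minimum of a Lipschitz function over a compact factor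
-- is again Lipschitz, so the minimum over z can be maximised over C.

module Submission where

open import Defs
open import Level using (Level; _⊔_; Lift; lift) renaming (suc to lsuc)
open import Data.Nat.Base as ℕ using (ℕ; zero; suc; NonZero)
open import Data.Integer.Base as ℤ using (ℤ; +_; -[1+_]; _⊖_; _◃_)
import Data.Integer.Properties as ℤ
open import Data.Sign.Base as Sign using (Sign)
open import Data.Fin.Base using (Fin; zero; suc; splitAt; _↑ˡ_; _↑ʳ_)
open import Data.Maybe.Base using (Maybe; just; nothing)
open import Data.Product using (Σ; ∃; ∃-syntax; _×_; _,_; proj₁; proj₂)
open import Data.Sum using (inj₁; inj₂)
open import Data.Sum.Properties using ([,]-map)
open import Data.Vec.Functional using (Vector; []; _∷_; _++_; head; tail)
open import Data.Vec.Functional.Properties using (lookup-++ˡ; lookup-++ʳ)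
open import Function.Base using (_∘_)
open import Relation.Nullary using (¬_; yes; no; contradiction)
open import Relation.Binary using (IsDecTotalOrder)
open import Relation.Binary.PropositionalEquality as ≡ using (_≡_)
open import Algebra.Bundles using (CommutativeRing)
open import Algebra.Solver.Ring.AlmostCommutativeRing
  using (fromCommutativeRing; _-Raw-AlmostCommutative⟶_)
import Algebra.Solver.Ring
import Algebra.Properties.Ring
import Algebra.Properties.AbelianGroup
import Algebra.Properties.Semiring.Mult.TCOptimised
import Algebra.Properties.Semiring.Sum
import Algebra.Construct.NaturalChoice.Max
import Relation.Binary.Reasoning.Setoid

-- Comparisons of two field elements may be split into cases, but the existence of a point with a
-- given property may not. Each attained extremum therefore comes from a supremum supplied by
-- completeness, together with an estimate that locates a point. Lipschitz constants make such
-- estimates explicit: a gap between two values of f becomes a radius by division, and a penalty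
-- whose slope is at least the constant of h can outweigh leaving {h ≤ 0}.
--
-- The minimising z may jump as the matrix moves; only the minimal value varies in a Lipschitz way,
-- and the outer maximum asks for no more. Since √ is not Lipschitz at 0, the objective is built
-- from squared moduli, which are polynomial in the coordinates; the monotone √ is applied to the
-- finished extrema.
--
-- Real matrices are embedded among the complex ones, so one attainment argument serves both sides.
-- The constant 2 is √4: the parallelogram law contributes one factor 2, the two stacked rows the
-- other.

module IntegerSolver {c ℓ} (R : CommutativeRing c ℓ) where
  open CommutativeRing R
  open Algebra.Properties.Ring ring
  open Algebra.Properties.AbelianGroup +-abelianGroup using (⁻¹-∙-comm)
  open Algebra.Properties.Semiring.Mult.TCOptimised semiring
    renaming (_×_ to _·_)
  open Relation.Binary.Reasoning.Setoid setoid

  -- 1 · x reduces to x here, so that numerals in solved goals compute.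
  ⟦_⟧ : ℤ → Carrier
  ⟦ + n ⟧      = n · 1#
  ⟦ -[1+ n ] ⟧ = - (suc n · 1#)

  [x+y]-[x+z]≈y-z : ∀ x y z → (x + y) + - (x + z) ≈ y + - z
  [x+y]-[x+z]≈y-z x y z = begin
    (x + y) + - (x + z)     ≈⟨ +-cong (+-comm x y) (sym (⁻¹-∙-comm x z)) ⟩
    (y + x) + (- x + - z)   ≈⟨ +-assoc y x _ ⟩
    y + (x + (- x + - z))   ≈⟨ +-congˡ (+-assoc x (- x) (- z)) ⟨
    y + ((x + - x) + - z)   ≈⟨ +-congˡ (+-congʳ (-‿inverseʳ x)) ⟩
    y + (0# + - z)          ≈⟨ +-congˡ (+-identityˡ (- z)) ⟩
    y + - z                 ∎

  ⊖-homo : ∀ m n → ⟦ m ⊖ n ⟧ ≈ m · 1# + - (n · 1#)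
  ⊖-homo m       zero    = begin
    m · 1#          ≈⟨ +-identityʳ _ ⟨
    m · 1# + 0#     ≈⟨ +-congˡ -0#≈0# ⟨
    m · 1# + - 0#   ∎
  ⊖-homo zero    (suc n) = sym (+-identityˡ _)
  ⊖-homo (suc m) (suc n) = begin
    ⟦ suc m ⊖ suc n ⟧                        ≡⟨ ≡.cong ⟦_⟧ (ℤ.[1+m]⊖[1+n]≡m⊖n m n) ⟩
    ⟦ m ⊖ n ⟧                                ≈⟨ ⊖-homo m n ⟩
    m · 1# + - (n · 1#)                      ≈⟨ [x+y]-[x+z]≈y-z 1# _ _ ⟨
    (1# + m · 1#) + - (1# + n · 1#)          ≈⟨ +-cong (1+× m 1#) (-‿cong (1+× n 1#)) ⟨
    suc m · 1# + - (suc n · 1#)              ∎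

  -‿homo : ∀ i → ⟦ ℤ.- i ⟧ ≈ - ⟦ i ⟧
  -‿homo (+ zero)  = sym -0#≈0#
  -‿homo (+ suc n) = refl
  -‿homo -[1+ n ]  = sym (-‿involutive _)

  +-homo : ∀ i j → ⟦ i ℤ.+ j ⟧ ≈ ⟦ i ⟧ + ⟦ j ⟧
  +-homo (+ m)    (+ n)    = ×-homo-+ 1# m n
  +-homo (+ m)    -[1+ n ] = ⊖-homo m (suc n)
  +-homo -[1+ m ] (+ n)    = trans (⊖-homo n (suc m)) (+-comm _ _)
  +-homo -[1+ m ] -[1+ n ] = begin
    - (suc (suc (m ℕ.+ n)) · 1#)        ≡⟨ ≡.cong (λ k → - (suc k · 1#)) (ℕₚ.+-suc m n) ⟨
    - ((suc m ℕ.+ suc n) · 1#)          ≈⟨ -‿cong (×-homo-+ 1# (suc m) (suc n)) ⟩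
    - (suc m · 1# + suc n · 1#)         ≈⟨ ⁻¹-∙-comm _ _ ⟨
    - (suc m · 1#) + - (suc n · 1#)     ∎
    where import Data.Nat.Properties as ℕₚ

  -◃-homo : ∀ n → ⟦ Sign.- ◃ n ⟧ ≈ - (n · 1#)
  -◃-homo zero    = sym -0#≈0#
  -◃-homo (suc n) = refl

  +◃-homo : ∀ n → ⟦ Sign.+ ◃ n ⟧ ≈ n · 1#
  +◃-homo zero    = refl
  +◃-homo (suc n) = refl

  *-homo : ∀ i j → ⟦ i ℤ.* j ⟧ ≈ ⟦ i ⟧ * ⟦ j ⟧
  *-homo (+ m)    (+ n)    = trans (+◃-homo (m ℕ.* n)) (×1-homo-* m n)
  *-homo (+ m)    -[1+ n ] = begin
    ⟦ Sign.- ◃ (m ℕ.* suc n) ⟧    ≈⟨ -◃-homo (m ℕ.* suc n) ⟩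
    - ((m ℕ.* suc n) · 1#)        ≈⟨ -‿cong (×1-homo-* m (suc n)) ⟩
    - (m · 1# * suc n · 1#)       ≈⟨ -‿distribʳ-* _ _ ⟩
    m · 1# * - (suc n · 1#)       ∎
  *-homo -[1+ m ] (+ n)    = begin
    ⟦ Sign.- ◃ (suc m ℕ.* n) ⟧    ≈⟨ -◃-homo (suc m ℕ.* n) ⟩
    - ((suc m ℕ.* n) · 1#)        ≈⟨ -‿cong (×1-homo-* (suc m) n) ⟩
    - (suc m · 1# * n · 1#)       ≈⟨ -‿distribˡ-* _ _ ⟩
    - (suc m · 1#) * n · 1#       ∎
  *-homo -[1+ m ] -[1+ n ] = begin
    (suc m ℕ.* suc n) · 1#              ≈⟨ ×1-homo-* (suc m) (suc n) ⟩
    suc m · 1# * suc n · 1#             ≈⟨ -‿involutive _ ⟨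
    - (- (suc m · 1# * suc n · 1#))     ≈⟨ -‿cong (-‿distribʳ-* _ _) ⟩
    - (suc m · 1# * - (suc n · 1#))     ≈⟨ -‿distribˡ-* _ _ ⟩
    - (suc m · 1#) * - (suc n · 1#)     ∎

  -- Coefficients are taken from ℤ, where equality is decided by computation, so that normal forms
  -- can cancel terms and collect numerals.
  homomorphism : ℤ.+-*-rawRing -Raw-AlmostCommutative⟶ fromCommutativeRing R
  homomorphism = record
    { ⟦_⟧ = ⟦_⟧ ; +-homo = +-homo ; *-homo = *-homo ; -‿homo = -‿homo
    ; 0-homo = refl ; 1-homo = refl }

  _coeff≟_ : ∀ i j → Maybe (⟦ i ⟧ ≈ ⟦ j ⟧)
  i coeff≟ j with i ℤ.≟ j
  ... | yes i≡j = just (reflexive (≡.cong ⟦_⟧ i≡j))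
  ... | no  _   = nothing

  open Algebra.Solver.Ring ℤ.+-*-rawRing (fromCommutativeRing R) homomorphism _coeff≟_ public
    using (solve; _:=_; _:+_; _:*_; _:-_; :-_; con)

module _ {c ℓ₁ ℓ₂} (F : CompleteOrderedField c ℓ₁ ℓ₂) where

  open CompleteOrderedField F
  open Komlós F
  open CommutativeRing commutativeRing
    using (ring; semiring; refl; sym; trans; reflexive; +-cong; +-congˡ; +-congʳ; *-cong; *-congˡ; *-congʳ;
           +-assoc; *-comm; +-identityˡ; +-identityʳ; *-identityˡ; *-identityʳ;
           -‿cong; -‿inverseʳ; zeroˡ; zeroʳ)
  open Algebra.Properties.Ring ring using (-0#≈0#)
  open IsDecTotalOrder isDecTotalOrder
    using (total; antisym; _≤?_; ≤-respˡ-≈; ≤-respʳ-≈)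
    renaming (refl to ≤-refl; trans to ≤-trans; reflexive to ≤-reflexive)
  open Algebra.Construct.NaturalChoice.Max totalOrder
    using (x≤x⊔y; x≤y⊔x; ⊔-lub; ⊔-mono-≤; ⊔-cong; mono-≤-distrib-⊔)
    renaming (_⊔_ to max)
  open Algebra.Properties.Semiring.Sum semiring
    using (sum; sum-cong-≋; sum-cong-≗; ∑-distrib-+)
  open IntegerSolver commutativeRing

  -- Inequalities in an ordered field

  ≰⇒≥ : ∀ {x y} → ¬ (x ≤ y) → y ≤ x
  ≰⇒≥ {x} {y} x≰y with total x y
  ... | inj₁ x≤y = contradiction x≤y x≰y
  ... | inj₂ y≤x = y≤x

  -- The main tool for inequalities: y - x is rewritten as an expression `t` that is nonnegative by
  -- its shape, and the solver checks the identity.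
  ≤-by-difference : ∀ {t x y} → 0# ≤ t → y + - x ≈ t → x ≤ y
  ≤-by-difference 0≤t eq = 0≤y-x⇒x≤y (≤-respʳ-≈ (sym eq) 0≤t)

  0≤+ : ∀ {x y} → 0# ≤ x → 0# ≤ y → 0# ≤ x + y
  0≤+ {x} {y} 0≤x 0≤y =
    ≤-trans 0≤y (≤-respˡ-≈ (+-identityˡ y) (+-monoˡ-≤ y 0≤x))

  +-mono-≤ : ∀ {x y u v} → x ≤ y → u ≤ v → x + u ≤ y + v
  +-mono-≤ {x} {y} {u} {v} x≤y u≤v =
    ≤-by-difference (0≤+ (x≤y⇒0≤y-x x≤y) (x≤y⇒0≤y-x u≤v))
      (solve 4 (λ x y u v → (y :+ v) :- (x :+ u) := (y :- x) :+ (v :- u)) refl x y u v)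

  -‿anti-≤ : ∀ {x y} → x ≤ y → - y ≤ - x
  -‿anti-≤ {x} {y} x≤y = ≤-by-difference (x≤y⇒0≤y-x x≤y)
    (solve 2 (λ x y → (:- x) :- (:- y) := y :- x) refl x y)

  *-monoˡ-≤ : ∀ {a x y} → 0# ≤ a → x ≤ y → a * x ≤ a * y
  *-monoˡ-≤ {a} {x} {y} 0≤a x≤y = ≤-by-difference (*-nonNeg 0≤a (x≤y⇒0≤y-x x≤y))
    (solve 3 (λ a x y → (a :* y) :- (a :* x) := a :* (y :- x)) refl a x y)

  *-monoʳ-≤ : ∀ {a x y} → 0# ≤ a → x ≤ y → x * a ≤ y * a
  *-monoʳ-≤ {a} {x} {y} 0≤a x≤y =
    ≤-respˡ-≈ (*-comm a x) (≤-respʳ-≈ (*-comm a y) (*-monoˡ-≤ 0≤a x≤y))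

  0≤x² : ∀ x → 0# ≤ x * x
  0≤x² x with total 0# x
  ... | inj₁ 0≤x = *-nonNeg 0≤x 0≤x
  ... | inj₂ x≤0 = ≤-respʳ-≈
    (solve 1 (λ x → (con (+ 0) :- x) :* (con (+ 0) :- x) := x :* x) refl x)
    (*-nonNeg (x≤y⇒0≤y-x x≤0) (x≤y⇒0≤y-x x≤0))

  0≤x+x⇒0≤x : ∀ {x} → 0# ≤ x + x → 0# ≤ x
  0≤x+x⇒0≤x {x} 0≤x+x with total 0# x
  ... | inj₁ 0≤x = 0≤x
  ... | inj₂ x≤0 = ≤-by-difference (0≤+ 0≤x+x (x≤y⇒0≤y-x x≤0))
    (solve 1 (λ x → x :- con (+ 0) := (x :+ x) :+ (con (+ 0) :- x)) refl x)

  -- A positive x would have an inverse y, and multiplying x² ≤ 0 by y² would give 1 ≤ 0.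
  x²≤0⇒x≤0 : ∀ {x} → x * x ≤ 0# → x ≤ 0#
  x²≤0⇒x≤0 {x} x²≤0 with x ≤? 0#
  ... | yes x≤0 = x≤0
  ... | no  x≰0 = contradiction x≤0 x≰0
    where
    x≉0 : ¬ (x ≈ 0#)
    x≉0 = x≰0 ∘ ≤-reflexive
    x≤0 : x ≤ 0#
    x≤0 with inverse x x≉0
    ... | y , xy≈1 = contradiction (antisym 0≤1 1≤0) 0≉1
      where
      1≤0 : 1# ≤ 0#
      1≤0 = ≤-respˡ-≈ (trans (solve 2 (λ x y → (x :* x) :* (y :* y) := (x :* y) :* (x :* y)) refl x y)
                        (trans (*-cong xy≈1 xy≈1) (*-identityʳ 1#)))
              (≤-respʳ-≈ (zeroˡ (y * y)) (*-monoʳ-≤ (0≤x² y) x²≤0))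

  -- If y ≤ x, then (x - y)² = (x² - y²) - 2y(x - y) is at most 0, so x - y ≤ 0.
  x*x≤y*y⇒x≤y : ∀ {x y} → 0# ≤ y → x * x ≤ y * y → x ≤ y
  x*x≤y*y⇒x≤y {x} {y} 0≤y x²≤y² with total x y
  ... | inj₁ x≤y = x≤y
  ... | inj₂ y≤x = 0≤y-x⇒x≤y (≤-respʳ-≈ (solve 2 (λ x y → con (+ 0) :- (x :- y) := y :- x) refl x y)
          (x≤y⇒0≤y-x (x²≤0⇒x≤0 (≤-by-difference
             (0≤+ (x≤y⇒0≤y-x x²≤y²) (0≤+ (*-nonNeg 0≤y (x≤y⇒0≤y-x y≤x)) (*-nonNeg 0≤y (x≤y⇒0≤y-x y≤x))))
             (solve 2 (λ x y → con (+ 0) :- (x :- y) :* (x :- y)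
                         := (y :* y :- x :* x) :+ (y :* (x :- y) :+ y :* (x :- y))) refl x y)))))

  1≰0 : ¬ (1# ≤ 0#)
  1≰0 1≤0 = 0≉1 (antisym 0≤1 1≤0)

  -- The sign comes from y = (a y) y = a y², a product of nonnegative factors.
  reciprocal : ∀ {a} → ¬ (a ≤ 0#) → ∃[ y ] 0# ≤ y × a * y ≈ 1#
  reciprocal {a} a≰0 with inverse a (a≰0 ∘ ≤-reflexive)
  ... | y , ay≈1 = y , 0≤y , ay≈1
    where
    0≤y : 0# ≤ y
    0≤y = ≤-respʳ-≈ (trans (solve 2 (λ a y → a :* (y :* y) := (a :* y) :* y) refl a y)
                      (trans (*-congʳ ay≈1) (*-identityˡ y)))
            (*-nonNeg (≰⇒≥ a≰0) (0≤x² y))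

  0≤a*x⇒0≤x : ∀ {a x} → ¬ (a ≤ 0#) → 0# ≤ a * x → 0# ≤ x
  0≤a*x⇒0≤x {a} {x} a≰0 0≤ax = let y , 0≤y , ay≈1 = reciprocal a≰0 in ≤-respʳ-≈
    (trans (solve 3 (λ a x y → (a :* x) :* y := (a :* y) :* x) refl a x y)
      (trans (*-congʳ ay≈1) (*-identityˡ x)))
    (*-nonNeg 0≤ax 0≤y)

  divide : ∀ {a} → ¬ (a ≤ 0#) → ∀ {b} → 0# ≤ b → ∃[ r ] 0# ≤ r × a * r ≈ b
  divide {a} a≰0 {b} 0≤b = let y , 0≤y , ay≈1 = reciprocal a≰0 in b * y , *-nonNeg 0≤b 0≤y ,
    trans (solve 3 (λ a b y → a :* (b :* y) := b :* (a :* y)) refl a b y)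
      (trans (*-congˡ ay≈1) (*-identityʳ b))

  -- Square roots

  √-nonNeg : ∀ x → 0# ≤ √ x
  √-nonNeg x = proj₁ (proj₂ (√-lub x)) 0# (inj₁ ≤-refl)

  -- The witness is e = d / a.
  square-below : ∀ {a s d} → 0# ≤ s → 0# ≤ d → a ≈ s + s + 1# + d →
                 ∃[ e ] (s + e) * (s + e) ≤ s * s + d × (e ≤ 0# → d ≤ 0#)
  square-below {a} {s} {d} 0≤s 0≤d a≈ = e , s+e²≤ , e≤0⇒d≤0
    where
    a≰0 : ¬ (a ≤ 0#)
    a≰0 a≤0 = 1≰0 (≤-trans (≤-by-difference (0≤+ (0≤+ 0≤s 0≤s) 0≤d)
      (trans (+-congʳ a≈)
        (solve 2 (λ s d → (s :+ s :+ con (+ 1) :+ d) :- con (+ 1) := s :+ s :+ d) refl s d))) a≤0)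
    quotient = divide a≰0 0≤d
    e = proj₁ quotient
    0≤e : 0# ≤ e
    0≤e = proj₁ (proj₂ quotient)
    ae≈d : a * e ≈ d
    ae≈d = proj₂ (proj₂ quotient)
    0≤1-e : 0# ≤ 1# + - e
    0≤1-e = 0≤a*x⇒0≤x a≰0 (≤-respʳ-≈
      (sym (trans (solve 2 (λ a e → a :* (con (+ 1) :- e) := a :- a :* e) refl a e)
        (trans (+-cong a≈ (-‿cong ae≈d))
          (solve 2 (λ s d → (s :+ s :+ con (+ 1) :+ d) :- d := s :+ s :+ con (+ 1)) refl s d))))
      (0≤+ (0≤+ 0≤s 0≤s) 0≤1))
    -- The choice a = 2s + 1 + d gives d - 2se - e² = e(1 - e) + ed, and e ≤ 1 because a(1 - e) = 2s
    -- + 1.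
    s+e²≤ : (s + e) * (s + e) ≤ s * s + d
    s+e²≤ = ≤-by-difference (0≤+ (*-nonNeg 0≤e 0≤1-e) (*-nonNeg 0≤e 0≤d))
      (trans (solve 3 (λ s e d → (s :* s :+ d) :- (s :+ e) :* (s :+ e)
                         := d :- (s :+ s) :* e :- e :* e) refl s e d)
        (trans (+-congʳ (+-congʳ (trans (sym ae≈d) (*-congʳ a≈))))
          (solve 3 (λ s e d → (s :+ s :+ con (+ 1) :+ d) :* e :- (s :+ s) :* e :- e :* e
                      := e :* (con (+ 1) :- e) :+ e :* d) refl s e d)))
    e≤0⇒d≤0 : e ≤ 0# → d ≤ 0#
    e≤0⇒d≤0 e≤0 = ≤-respˡ-≈ ae≈d (≤-respʳ-≈ (zeroʳ a) (*-monoˡ-≤ (≰⇒≥ a≰0) e≤0))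

  lub-square : ∀ {x s} → 0# ≤ x → IsLeastUpperBound (SqrtSet x) s → s * s ≈ x
  lub-square {x} {s} 0≤x (upper , least) = antisym s²≤x x≤s²
    where
    0≤s : 0# ≤ s
    0≤s = upper 0# (inj₁ ≤-refl)

    -- If x < s², then s − e = (s + x / s) / 2 is a smaller upper bound.
    s²≤x : s * s ≤ x
    s²≤x with s * s ≤? x | s + s ≤? 0#
    ... | yes p | _ = p
    ... | no  _ | yes 2s≤0 = ≤-trans (≤-by-difference
            (0≤+ (*-nonNeg 0≤s 0≤s) (*-nonNeg 0≤s (x≤y⇒0≤y-x 2s≤0)))
            (solve 1 (λ s → con (+ 0) :- s :* s := s :* s :+ s :* (con (+ 0) :- (s :+ s))) refl s)) 0≤x
    ... | no ¬p | no 2s≰0 = 0≤y-x⇒x≤y (≤-respʳ-≈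
            (trans (solve 2 (λ s e → (s :+ s) :* ((s :- e) :- s) := :- ((s :+ s) :* e)) refl s e)
              (trans (-‿cong 2se≈s²-x) (solve 2 (λ s x → :- (s :* s :- x) := x :- s :* s) refl s x)))
            (*-nonNeg (≰⇒≥ 2s≰0) (x≤y⇒0≤y-x (least (s + - e) bound))))
      where
      quotient = divide 2s≰0 (x≤y⇒0≤y-x (≰⇒≥ ¬p))
      e = proj₁ quotient
      2se≈s²-x : (s + s) * e ≈ s * s + - x
      2se≈s²-x = proj₂ (proj₂ quotient)
      2s[s-e-y] : ∀ y → (s + s) * ((s + - e) + - y) ≈ s * s + x + - ((s + s) * y)
      2s[s-e-y] y = trans
        (solve 3 (λ s e y → (s :+ s) :* ((s :- e) :- y)
                    := (s :* s :+ s :* s :- (s :+ s) :* y) :- (s :+ s) :* e) refl s e y)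
        (trans (+-congˡ (-‿cong 2se≈s²-x))
          (solve 3 (λ s x y → (s :* s :+ s :* s :- (s :+ s) :* y) :- (s :* s :- x)
                      := s :* s :+ x :- (s :+ s) :* y) refl s x y))
      -- Multiplied by 2s, the gap s - e - y becomes s² + x - 2sy. This is a sum of nonnegative
      -- terms if y ≤ 0, and equals (s - y)² + (x - y²) in any case.
      bound : ∀ y → SqrtSet x y → y ≤ s + - e
      bound y (inj₁ y≤0) = 0≤y-x⇒x≤y (0≤a*x⇒0≤x 2s≰0 (≤-respʳ-≈
        (sym (trans (2s[s-e-y] y)
          (solve 3 (λ s x y → s :* s :+ x :- (s :+ s) :* y
                      := (s :* s :+ x) :+ (s :+ s) :* (con (+ 0) :- y)) refl s x y)))
        (0≤+ (0≤+ (0≤x² s) 0≤x) (*-nonNeg (≰⇒≥ 2s≰0) (x≤y⇒0≤y-x y≤0)))))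
      bound y (inj₂ y²≤x) = 0≤y-x⇒x≤y (0≤a*x⇒0≤x 2s≰0 (≤-respʳ-≈
        (sym (trans (2s[s-e-y] y)
          (solve 3 (λ s x y → s :* s :+ x :- (s :+ s) :* y
                      := (s :- y) :* (s :- y) :+ (x :- y :* y)) refl s x y)))
        (0≤+ (0≤x² (s + - y)) (x≤y⇒0≤y-x y²≤x))))

    x≤s² : x ≤ s * s
    x≤s² = 0≤y-x⇒x≤y (≤-respʳ-≈ (solve 2 (λ s x → con (+ 0) :- (x :- s :* s) := s :* s :- x) refl s x)
      (x≤y⇒0≤y-x x-s²≤0))
      where
      x-s²≤0 : x + - (s * s) ≤ 0#
      x-s²≤0 with x + - (s * s) ≤? 0#
      ... | yes p = p
      -- With d = x - s² the point s + e lies in the set, so s + e ≤ s; hence e ≤ 0, and then d ≤ 0.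
      ... | no ¬p = let e , s+e²≤ , e≤0⇒ = square-below 0≤s (≰⇒≥ ¬p) refl in
        e≤0⇒ (0≤y-x⇒x≤y (≤-respʳ-≈ (solve 2 (λ s e → s :- (s :+ e) := con (+ 0) :- e) refl s e)
          (x≤y⇒0≤y-x (upper (s + e) (inj₂ (≤-trans s+e²≤
            (≤-reflexive (solve 2 (λ s x → s :* s :+ (x :- s :* s) := x) refl s x))))))))

  √-square : ∀ {x} → 0# ≤ x → √ x * √ x ≈ x
  √-square {x} 0≤x = lub-square 0≤x (proj₂ (√-lub x))

  √-mono-≤ : ∀ {x y} → x ≤ y → √ x ≤ √ y
  √-mono-≤ {x} {y} x≤y = proj₂ (proj₂ (√-lub x)) (√ y) bound
    where
    bound : ∀ z → SqrtSet x z → z ≤ √ y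
    bound z (inj₁ z≤0)  = proj₁ (proj₂ (√-lub y)) z (inj₁ z≤0)
    bound z (inj₂ z²≤x) = proj₁ (proj₂ (√-lub y)) z (inj₂ (≤-trans z²≤x x≤y))

  √-cong : ∀ {x y} → x ≈ y → √ x ≈ √ y
  √-cong x≈y = antisym (√-mono-≤ (≤-reflexive x≈y)) (√-mono-≤ (≤-reflexive (sym x≈y)))

  √-square-nonNeg : ∀ {x} → 0# ≤ x → √ (x * x) ≈ x
  √-square-nonNeg {x} 0≤x = antisym
    (x*x≤y*y⇒x≤y 0≤x (≤-reflexive (√-square (0≤x² x))))
    (proj₁ (proj₂ (√-lub (x * x))) x (inj₂ ≤-refl))

  √0≈0 : √ 0# ≈ 0#
  √0≈0 = trans (√-cong (sym (zeroˡ 0#))) (√-square-nonNeg ≤-refl)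

  √1≈1 : √ 1# ≈ 1#
  √1≈1 = trans (√-cong (sym (*-identityˡ 1#))) (√-square-nonNeg 0≤1)

  √x≤1⇒x≤1 : ∀ {x} → 0# ≤ x → √ x ≤ 1# → x ≤ 1#
  √x≤1⇒x≤1 {x} 0≤x √x≤1 = ≤-trans (≤-reflexive (sym (√-square 0≤x)))
    (≤-trans (*-monoˡ-≤ (√-nonNeg x) √x≤1) (≤-trans (≤-reflexive (*-identityʳ _)) √x≤1))

  x≤1⇒√x≤1 : ∀ {x} → x ≤ 1# → √ x ≤ 1#
  x≤1⇒√x≤1 x≤1 = ≤-trans (√-mono-≤ x≤1) (≤-reflexive √1≈1)

  √x≈1⇒x≈1 : ∀ {x} → 0# ≤ x → √ x ≈ 1# → x ≈ 1#
  √x≈1⇒x≈1 0≤x √x≈1 = trans (sym (√-square 0≤x)) (trans (*-cong √x≈1 √x≈1) (*-identityʳ 1#))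

  -- Two-sided bounds and absolute values

  infix 4 _within_

  -- Encodes |x| ≤ b as two linear inequalities, so that bounds can be added and multiplied by
  -- ordered-field arithmetic. `abs` appears where a bound must itself be a number.
  _within_ : Carrier → Carrier → Set ℓ₂
  x within b = - b ≤ x × x ≤ b

  within-respˡ-≈ : ∀ {x y b} → x ≈ y → x within b → y within b
  within-respˡ-≈ x≈y (lo , hi) = ≤-respʳ-≈ x≈y lo , ≤-respˡ-≈ x≈y hi

  within-weaken : ∀ {x a b} → a ≤ b → x within a → x within b
  within-weaken a≤b (lo , hi) = ≤-trans (-‿anti-≤ a≤b) lo , ≤-trans hi a≤b

  within-+ : ∀ {x y a b} → x within a → y within b → x + y within a + b
  within-+ {a = a} {b} (lo , hi) (lo′ , hi′) =
    ≤-respˡ-≈ (solve 2 (λ a b → :- a :+ :- b := :- (a :+ b)) refl a b) (+-mono-≤ lo lo′) ,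
    +-mono-≤ hi hi′

  within-neg : ∀ {x b} → x within b → - x within b
  within-neg {x} {b} (lo , hi) = -‿anti-≤ hi ,
    ≤-respʳ-≈ (solve 1 (λ b → :- (:- b) := b) refl b) (-‿anti-≤ lo)

  -- 2(ab - xy) = (a - x)(y + b) + (x + a)(b - y), with all four factors nonnegative. The lower
  -- bound is this upper bound with -x in place of x.
  within-* : ∀ {x y a b} → x within a → y within b → x * y within a * b
  within-* {x} {y} {a} {b} p q = lower , upper x (proj₁ p) (proj₂ p)
    where
    upper : ∀ x → - a ≤ x → x ≤ a → x * y ≤ a * b
    upper x lo hi = 0≤y-x⇒x≤y (0≤x+x⇒0≤x (≤-respʳ-≈
      (solve 4 (λ x y a b → (a :- x) :* (y :- (:- b)) :+ (x :- (:- a)) :* (b :- y)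
                  := (a :* b :- x :* y) :+ (a :* b :- x :* y)) refl x y a b)
      (0≤+ (*-nonNeg (x≤y⇒0≤y-x hi) (x≤y⇒0≤y-x (proj₁ q)))
           (*-nonNeg (x≤y⇒0≤y-x lo) (x≤y⇒0≤y-x (proj₂ q))))))
    lower : - (a * b) ≤ x * y
    lower = ≤-respʳ-≈ (solve 2 (λ x y → :- ((:- x) :* y) := x :* y) refl x y)
      (-‿anti-≤ (upper (- x) (proj₁ (within-neg p)) (proj₂ (within-neg p))))

  within⇒0≤ : ∀ {x b} → x within b → 0# ≤ b
  within⇒0≤ {x} {b} (lo , hi) = 0≤x+x⇒0≤x (≤-respʳ-≈
    (solve 1 (λ b → b :- (:- b) := b :+ b) refl b) (x≤y⇒0≤y-x (≤-trans lo hi)))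

  0-within : ∀ {b} → 0# ≤ b → 0# within b
  0-within {b} 0≤b = ≤-respʳ-≈ -0#≈0# (-‿anti-≤ 0≤b) , 0≤b

  abs : Carrier → Carrier
  abs x = max x (- x)

  within-abs : ∀ x → x within abs x
  within-abs x = ≤-respʳ-≈ (solve 1 (λ x → :- (:- x) := x) refl x) (-‿anti-≤ (x≤y⊔x x (- x))) ,
    x≤x⊔y x (- x)

  abs-least : ∀ {x b} → x within b → abs x ≤ b
  abs-least x∈ = ⊔-lub (proj₂ x∈) (proj₂ (within-neg x∈))

  x²≤1⇒x-within-1 : ∀ {x} → x * x ≤ 1# → x within 1#
  x²≤1⇒x-within-1 {x} x²≤1 =
    ≤-respʳ-≈ (solve 1 (λ x → :- (:- x) := x) refl x) (-‿anti-≤ (upper (- x)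
      (≤-respˡ-≈ (solve 1 (λ x → x :* x := (:- x) :* (:- x)) refl x) x²≤1))) ,
    upper x x²≤1
    where
    upper : ∀ x → x * x ≤ 1# → x ≤ 1#
    upper x x²≤1 = x*x≤y*y⇒x≤y 0≤1 (≤-respʳ-≈ (sym (*-identityˡ 1#)) x²≤1)

  -- Compactness

  -- A pseudometric: distinct points may have distance zero. Pointwise equal families, and points of
  -- a subset with different membership proofs, are thereby indistinguishable to Lipschitz
  -- functions.
  record Space a : Set (c ⊔ ℓ₂ ⊔ lsuc a) where
    field
      Point       : Set a
      dist        : Point → Point → Carrier
      dist-nonNeg : ∀ x y → 0# ≤ dist x y
      dist-self   : ∀ x → dist x x ≤ 0#
      dist-sym    : ∀ x y → dist x y ≤ dist y x
      triangle    : ∀ x y z → dist x z ≤ dist x y + dist y z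

  open Space

  private variable
    a b : Level
    X : Space a
    Y : Space b

  record Lipschitz (X : Space a) (f : Point X → Carrier) : Set (a ⊔ c ⊔ ℓ₂) where
    field
      constant        : Carrier
      constant-nonNeg : 0# ≤ constant
      increment       : ∀ x y → f x + - f y within constant * dist X x y

    f[x]≤f[y]+Ld : ∀ x y → f x ≤ f y + constant * dist X x y
    f[x]≤f[y]+Ld x y = ≤-respˡ-≈ (solve 2 (λ u v → v :+ (u :- v) := u) refl (f x) (f y))
      (+-mono-≤ ≤-refl (proj₂ (increment x y)))

  open Lipschitz

  lipschitz : ∀ {f} L → 0# ≤ L → (∀ x y → f x ≤ f y + L * dist X x y) → Lipschitz X f
  lipschitz {X = X} {f} L 0≤L f≤ = record
    { constant        = L
    ; constant-nonNeg = 0≤L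
    ; increment       = λ x y →
        ≤-respʳ-≈ (solve 2 (λ u v → :- (u :- v) := v :- u) refl (f y) (f x))
          (-‿anti-≤ (≤-trans (upper y x) (*-monoˡ-≤ 0≤L (dist-sym X y x)))) ,
        upper x y
    }
    where
    upper : ∀ x y → f x + - f y ≤ L * dist X x y
    upper x y = ≤-respʳ-≈ (solve 2 (λ v d → (v :+ d) :- v := d) refl (f y) (L * dist X x y))
      (+-monoˡ-≤ (- f y) (f≤ x y))

  NonExpansive : (X : Space a) (Y : Space b) → (Point X → Point Y) → Set (a ⊔ ℓ₂)
  NonExpansive X Y r = ∀ x x′ → dist Y (r x) (r x′) ≤ dist X x x′

  Lipschitz-∘ : ∀ {f r} → Lipschitz Y f → NonExpansive X Y r → Lipschitz X (f ∘ r)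
  Lipschitz-∘ lip r≤ = record
    { constant        = constant lip
    ; constant-nonNeg = constant-nonNeg lip
    ; increment       = λ x x′ → within-weaken
        (*-monoˡ-≤ (constant-nonNeg lip) (r≤ x x′)) (increment lip _ _)
    }

  Lipschitz-neg : ∀ {f} → Lipschitz X f → Lipschitz X (λ x → - f x)
  Lipschitz-neg {f = f} lip = record
    { constant        = constant lip
    ; constant-nonNeg = constant-nonNeg lip
    ; increment       = λ x y → within-respˡ-≈
        (solve 2 (λ u v → :- (u :- v) := (:- u) :- (:- v)) refl (f x) (f y))
        (within-neg (increment lip x y))
    }

  -- For metric spaces this is equivalent to the usual notion.
  Compact : Space a → Set (a ⊔ c ⊔ ℓ₂)
  Compact X = ∀ {f} → Lipschitz X f → ∃[ x ] (∀ y → f y ≤ f x)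

  interval : Space (c ⊔ ℓ₂)
  interval = record
    { Point       = Σ Carrier (_within 1#)
    ; dist        = λ x y → abs (proj₁ x + - proj₁ y)
    ; dist-nonNeg = λ x y → within⇒0≤ (within-abs _)
    ; dist-self   = λ x → abs-least (within-respˡ-≈
        (solve 1 (λ x → con (+ 0) := x :- x) refl (proj₁ x)) (0-within ≤-refl))
    ; dist-sym    = λ x y → abs-least (within-respˡ-≈
        (solve 2 (λ x y → :- (y :- x) := x :- y) refl (proj₁ x) (proj₁ y))
        (within-neg (within-abs _)))
    ; triangle    = λ x y z → abs-least (within-respˡ-≈
        (solve 3 (λ x y z → (x :- y) :+ (y :- z) := x :- z) refl (proj₁ x) (proj₁ y) (proj₁ z))
        (within-+ (within-abs _) (within-abs _)))
    }

  _×ˢ_ : Space a → Space b → Space (a ⊔ b)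
  X ×ˢ Y = record
    { Point       = Point X × Point Y
    ; dist        = λ (x , y) (x′ , y′) → dist X x x′ + dist Y y y′
    ; dist-nonNeg = λ _ _ → 0≤+ (dist-nonNeg X _ _) (dist-nonNeg Y _ _)
    ; dist-self   = λ _ → ≤-respʳ-≈ (+-identityˡ 0#) (+-mono-≤ (dist-self X _) (dist-self Y _))
    ; dist-sym    = λ _ _ → +-mono-≤ (dist-sym X _ _) (dist-sym Y _ _)
    ; triangle    = λ _ _ _ → ≤-respʳ-≈
        (solve 4 (λ s t u v → (s :+ t) :+ (u :+ v) := (s :+ u) :+ (t :+ v)) refl _ _ _ _)
        (+-mono-≤ (triangle X _ _ _) (triangle Y _ _ _))
    }

  sum-mono-≤ : ∀ {n} {u v : Vector Carrier n} → (∀ i → u i ≤ v i) → sum u ≤ sum v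
  sum-mono-≤ {zero}  u≤v = ≤-refl
  sum-mono-≤ {suc n} u≤v = +-mono-≤ (u≤v zero) (sum-mono-≤ (u≤v ∘ suc))

  0≤sum : ∀ {n} {u : Vector Carrier n} → (∀ i → 0# ≤ u i) → 0# ≤ sum u
  0≤sum {zero}  0≤u = ≤-refl
  0≤sum {suc n} 0≤u = 0≤+ (0≤u zero) (0≤sum (0≤u ∘ suc))

  ≤sum : ∀ {n} {u : Vector Carrier n} → (∀ i → 0# ≤ u i) → ∀ i → u i ≤ sum u
  ≤sum {suc n} {u} 0≤u zero = ≤-respˡ-≈ (+-identityʳ (u zero))
    (+-mono-≤ ≤-refl (0≤sum (0≤u ∘ suc)))
  ≤sum {suc n} {u} 0≤u (suc i) = ≤-respˡ-≈ (+-identityˡ (u (suc i)))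
    (+-mono-≤ (0≤u zero) (≤sum (0≤u ∘ suc) i))

  sum≤0 : ∀ {n} {u : Vector Carrier n} → (∀ i → u i ≤ 0#) → sum u ≤ 0#
  sum≤0 {zero}  u≤0 = ≤-refl
  sum≤0 {suc n} u≤0 = ≤-respʳ-≈ (+-identityˡ 0#) (+-mono-≤ (u≤0 zero) (sum≤0 (u≤0 ∘ suc)))

  -- The sum metric makes the distance on families of length n + 1 compute to that of head and tail
  -- in a product, so prepending a coordinate is an isometry by definition.
  _^ˢ_ : Space a → ℕ → Space a
  X ^ˢ n = record
    { Point       = Fin n → Point X
    ; dist        = λ x y → sum (λ i → dist X (x i) (y i))
    ; dist-nonNeg = λ x y → 0≤sum (λ i → dist-nonNeg X (x i) (y i))
    ; dist-self   = λ x → sum≤0 (λ i → dist-self X (x i))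
    ; dist-sym    = λ x y → sum-mono-≤ (λ i → dist-sym X (x i) (y i))
    ; triangle    = λ x y z → ≤-trans (sum-mono-≤ (λ i → triangle X (x i) (y i) (z i)))
        (≤-reflexive (∑-distrib-+ (λ i → dist X (x i) (y i)) (λ i → dist X (y i) (z i))))
    }

  _∣_≤0 : (X : Space a) → (Point X → Carrier) → Space (a ⊔ ℓ₂)
  X ∣ h ≤0 = record
    { Point       = Σ (Point X) (λ x → h x ≤ 0#)
    ; dist        = λ x y → dist X (proj₁ x) (proj₁ y)
    ; dist-nonNeg = λ x y → dist-nonNeg X (proj₁ x) (proj₁ y)
    ; dist-self   = λ x → dist-self X (proj₁ x)
    ; dist-sym    = λ x y → dist-sym X (proj₁ x) (proj₁ y)
    ; triangle    = λ x y z → triangle X (proj₁ x) (proj₁ y) (proj₁ z)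
    }

  -- Maxima on the interval

  supremum : (P : Carrier → Set (c ⊔ ℓ₂)) → ∃ P → ∃ (IsUpperBound P) → ∃ (IsLeastUpperBound P)
  supremum P (x , Px) (b , b-ub) =
    let s , upper , least = complete (λ y → Lift ℓ₁ (P y)) (x , lift Px) (b , λ y Py → b-ub y (Lift.lower Py))
    in s , (λ y Py → upper y (lift Py)) , (λ u u-ub → least u (λ y Py → u-ub y (Lift.lower Py)))

  -- Discarding the points below t does not lower the supremum of f.  The
  -- largest such t is the last maximiser.
  Retains : (Point interval → Carrier) → Carrier → Set (c ⊔ ℓ₂)
  Retains f t = ∀ x → ∃[ y ] t ≤ proj₁ y × f x ≤ f y

  module _ {f} (lip : Lipschitz interval f) {s} (s∈ : s within 1#)
           (s-lub : IsLeastUpperBound (Retains f) s) where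

    private
      L = constant lip
      upper = proj₁ s-lub
      least = proj₂ s-lub
      p : Point interval
      p = s , s∈

    module _ {x₀ r} (0≤r : 0# ≤ r) (far : ¬ (f x₀ ≤ f p + L * r)) where

      near-p : ∀ y → s + - r ≤ proj₁ y → proj₁ y ≤ s + r → f y ≤ f p + L * r
      near-p y s-r≤y y≤s+r = ≤-trans (f[x]≤f[y]+Ld lip y p)
        (+-mono-≤ ≤-refl (*-monoˡ-≤ (constant-nonNeg lip) (abs-least
          ( ≤-respˡ-≈ (solve 2 (λ s r → (s :- r) :- s := :- r) refl s r) (+-monoˡ-≤ (- s) s-r≤y)
          , ≤-respʳ-≈ (solve 2 (λ s r → (s :+ r) :- s := r) refl s r) (+-monoˡ-≤ (- s) y≤s+r)))))

      -- Within distance r of s, f stays below f x₀, so y cannot lie there; being past s - r, it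
      -- must be past s + r.
      beyond-p : ∀ y → s + - r ≤ proj₁ y → f x₀ ≤ f y → s + r ≤ proj₁ y
      beyond-p y s-r≤y f[x₀]≤f[y] with total (s + r) (proj₁ y)
      ... | inj₁ s+r≤y = s+r≤y
      ... | inj₂ y≤s+r = contradiction (≤-trans f[x₀]≤f[y] (near-p y s-r≤y y≤s+r)) far

      -- A point no better than `x₀` is first replaced by `x₀`. What t then retains is at least as
      -- good as `x₀`, and `beyond-p` pushes it past s + r.
      retains-s+r : ∀ t → Retains f t → s + - r ≤ t → Retains f (s + r)
      retains-s+r t Tt s-r≤t x with total (f x₀) (f x)
      ... | inj₁ f[x₀]≤f[x] = let y , t≤y , f[x]≤f[y] = Tt x in
        y , beyond-p y (≤-trans s-r≤t t≤y) (≤-trans f[x₀]≤f[x] f[x]≤f[y]) , f[x]≤f[y]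
      ... | inj₂ f[x]≤f[x₀] = let y , t≤y , f[x₀]≤f[y] = Tt x₀ in
        y , beyond-p y (≤-trans s-r≤t t≤y) f[x₀]≤f[y] , ≤-trans f[x]≤f[x₀] f[x₀]≤f[y]

      -- A retained t ≥ s - r would make s + r retained too, so s + r ≤ s and t ≤ s ≤ s - r.
      -- Leastness of s then yields `radius≤0`.
      s-r-upper : ∀ t → Retains f t → t ≤ s + - r
      s-r-upper t Tt with total t (s + - r)
      ... | inj₁ t≤s-r = t≤s-r
      ... | inj₂ s-r≤t = ≤-trans (upper t Tt) (≤-by-difference
        (x≤y⇒0≤y-x (upper (s + r) (retains-s+r t Tt s-r≤t)))
        (solve 2 (λ s r → (s :- r) :- s := s :- (s :+ r)) refl s r))

      radius≤0 : r ≤ 0#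
      radius≤0 = ≤-by-difference (x≤y⇒0≤y-x (least (s + - r) s-r-upper))
        (solve 2 (λ s r → con (+ 0) :- r := (s :- r) :- s) refl s r)

    -- The factor is L + 1 because L may be 0. With δ = f x₀ - f p = (L + 1) r, the case f x₀ ≤ f p
    -- + L r says δ ≤ L r, that is, r ≤ 0.
    radius-scaled : ∀ {x₀ r} → 0# ≤ r → (L + 1#) * r ≈ f x₀ + - f p → r ≤ 0#
    radius-scaled {x₀} {r} 0≤r ar≈δ with f x₀ ≤? f p + L * r
    ... | no far   = radius≤0 0≤r far
    ... | yes near = ≤-by-difference (x≤y⇒0≤y-x near)
          (trans (solve 2 (λ L r → con (+ 0) :- r := L :* r :- (L :+ con (+ 1)) :* r) refl L r)
            (trans (+-congˡ (-‿cong ar≈δ))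
              (solve 3 (λ k u v → k :- (u :- v) := (v :+ k) :- u) refl (L * r) (f x₀) (f p))))

    last-maximal : ∀ x₀ → f x₀ ≤ f p
    last-maximal x₀ with f x₀ ≤? f p
    ... | yes q = q
    ... | no ¬q = 0≤y-x⇒x≤y (≤-respʳ-≈
            (trans (solve 2 (λ a r → a :* (con (+ 0) :- r) := :- (a :* r)) refl (L + 1#) (proj₁ quotient))
              (trans (-‿cong (proj₂ (proj₂ quotient)))
                (solve 2 (λ u v → :- (u :- v) := v :- u) refl (f x₀) (f p))))
            (*-nonNeg (≰⇒≥ a≰0) (x≤y⇒0≤y-x
              (radius-scaled (proj₁ (proj₂ quotient)) (proj₂ (proj₂ quotient))))))
      where
      a≰0 : ¬ (L + 1# ≤ 0#)
      a≰0 a≤0 = 1≰0 (≤-trans (≤-by-difference (constant-nonNeg lip)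
        (solve 1 (λ L → (L :+ con (+ 1)) :- con (+ 1) := L) refl L)) a≤0)
      quotient : ∃[ r ] 0# ≤ r × (L + 1#) * r ≈ f x₀ + - f p
      quotient = divide a≰0 (x≤y⇒0≤y-x (≰⇒≥ ¬q))

  interval-compact : Compact interval
  interval-compact {f} lip =
    let s , s-lub@(upper , least) = supremum (Retains f) (- 1# , retains[-1]) (1# , 1-upper)
        s∈ = upper (- 1#) retains[-1] , least 1# 1-upper
    in (s , s∈) , last-maximal lip s∈ s-lub
    where
    retains[-1] : Retains f (- 1#)
    retains[-1] x = x , proj₁ (proj₂ x) , ≤-refl
    1-upper : IsUpperBound (Retains f) 1#
    1-upper t Tt = let y , t≤y , _ = Tt (0# , 0-within 0≤1) in ≤-trans t≤y (proj₂ (proj₂ y))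

  -- Products, partial extrema and finite powers

  Lipschitz-section : ∀ {f} → Lipschitz (X ×ˢ Y) f → ∀ x → Lipschitz Y (λ y → f (x , y))
  Lipschitz-section {X = X} lip x = Lipschitz-∘ lip (λ _ _ →
    ≤-respʳ-≈ (+-identityˡ _) (+-mono-≤ (dist-self X x) ≤-refl))

  module _ {X : Space a} {Y : Space b} {f} (Y-compact : Compact Y) (lip : Lipschitz (X ×ˢ Y) f) where

    partial-maximum : ∀ x → ∃[ y ] (∀ y′ → f (x , y′) ≤ f (x , y))
    partial-maximum x = Y-compact {λ y → f (x , y)} (Lipschitz-section {X = X} {Y = Y} {f} lip x)

    argmax : Point X → Point Y
    argmax x = proj₁ (partial-maximum x)

    argmax-maximal : ∀ x y → f (x , y) ≤ f (x , argmax x)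
    argmax-maximal x = proj₂ (partial-maximum x)

    -- `argmax` may jump, but keeping the maximiser of x while moving to x′ costs at most L d(x,
    -- x′), and maximising afresh at x′ only raises the value.
    partial-maximum-Lipschitz : Lipschitz X (λ x → f (x , argmax x))
    partial-maximum-Lipschitz = lipschitz (constant lip) (constant-nonNeg lip) (λ x x′ →
      ≤-trans (f[x]≤f[y]+Ld lip (x , argmax x) (x′ , argmax x))
        (+-mono-≤ (argmax-maximal x′ (argmax x))
          (*-monoˡ-≤ (constant-nonNeg lip)
            (≤-respʳ-≈ (+-identityʳ (dist X x x′)) (+-mono-≤ ≤-refl (dist-self Y (argmax x)))))))

  ×-compact : Compact X → Compact Y → Compact (X ×ˢ Y)
  ×-compact X-compact Y-compact lip =
    let x , x-maximal = X-compact (partial-maximum-Lipschitz Y-compact lip)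
    in (x , argmax Y-compact lip x) ,
       (λ (x′ , y) → ≤-trans (argmax-maximal Y-compact lip x′ y) (x-maximal x′))

  -‿cancel-≤ : ∀ {x y} → - x ≤ - y → y ≤ x
  -‿cancel-≤ {x} {y} -x≤-y = ≤-by-difference (x≤y⇒0≤y-x -x≤-y)
    (solve 2 (λ x y → x :- y := (:- y) :- (:- x)) refl x y)

  -- The inner minimum is minus the partial maximum of -f, whence the double negation. Returning `r`
  -- as a function keeps a minimiser for every x, as each single discrepancy needs its own witness.
  max-min : ∀ {X : Space a} {Y : Space b} {f : Point (X ×ˢ Y) → Carrier} →
            Compact X → Compact Y → Lipschitz (X ×ˢ Y) f →
            Σ (Point X → Point Y) λ r →
              (∀ x y → f (x , r x) ≤ f (x , y)) × ∃[ x ] (∀ x′ → f (x′ , r x′) ≤ f (x , r x))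
  max-min {X = X} {Y} {f} X-compact Y-compact lip =
    r ,
    (λ x y → -‿cancel-≤ (argmax-maximal {X = X} {Y} {λ w → - f w} Y-compact -f-lip x y)) ,
    let x , maximal = X-compact {λ x → - (- f (x , r x))}
          (Lipschitz-neg (partial-maximum-Lipschitz {X = X} {Y} {λ w → - f w} Y-compact -f-lip))
    in x , (λ x′ → -‿cancel-≤ (-‿cancel-≤ (maximal x′)))
    where
    -f-lip : Lipschitz (X ×ˢ Y) (λ w → - f w)
    -f-lip = Lipschitz-neg lip
    r : Point X → Point Y
    r = argmax {X = X} {Y} {λ w → - f w} Y-compact -f-lip

  -- Needed because x and head x ∷ tail x agree only pointwise.
  Lipschitz-respects-dist : ∀ {f} → Lipschitz X f → ∀ {x y} → dist X x y ≤ 0# → f x ≤ f y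
  Lipschitz-respects-dist lip d≤0 = ≤-trans (f[x]≤f[y]+Ld lip _ _)
    (≤-trans (+-mono-≤ ≤-refl (*-monoˡ-≤ (constant-nonNeg lip) d≤0))
      (≤-reflexive (trans (+-congˡ (zeroʳ _)) (+-identityʳ _))))

  ^-compact : Compact X → ∀ n → Compact (X ^ˢ n)
  ^-compact X-compact zero    lip = (λ ()) , (λ _ → Lipschitz-respects-dist lip ≤-refl)
  ^-compact {X = X} X-compact (suc n) lip =
    let (x , xs) , maximal = ×-compact X-compact (^-compact X-compact n)
          (Lipschitz-∘ {r = λ (x , xs) → x ∷ xs} lip (λ _ _ → ≤-refl))
    in x ∷ xs , (λ y → ≤-trans
         (Lipschitz-respects-dist lip (sum≤0 {u = λ i → dist X (y i) ((head y ∷ tail y) i)}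
           λ { zero → dist-self X (y zero) ; (suc i) → dist-self X (y (suc i)) }))
         (maximal (head y , tail y)))

  -- f on {h ≤ 0} extends to the McShane function sup_k (f k − K d(x, k)) on X.
  -- For K at least the sum of the Lipschitz constants of f and h, the maximum
  -- of the extension can only be attained inside {h ≤ 0}.
  module _ {X : Space (c ⊔ ℓ₂)} {h : Point X → Carrier} (h-lip : Lipschitz X h)
           (origin : Point (X ∣ h ≤0)) {f} (lip : Lipschitz (X ∣ h ≤0) f) where

    private
      K = constant lip + constant h-lip
      0≤K : 0# ≤ K
      0≤K = 0≤+ (constant-nonNeg lip) (constant-nonNeg h-lip)
      L≤K : constant lip ≤ K
      L≤K = ≤-respˡ-≈ (+-identityʳ _) (+-mono-≤ ≤-refl (constant-nonNeg h-lip))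
      H≤K : constant h-lip ≤ K
      H≤K = ≤-respˡ-≈ (+-identityˡ _) (+-mono-≤ (constant-nonNeg lip) ≤-refl)

    Below : Point X → Carrier → Set (c ⊔ ℓ₂)
    Below x t = ∃[ k ] t ≤ f k + - (K * dist X x (proj₁ k))

    -- Going from `origin` to k through x bounds f k by f(origin) + K(d(origin, x) + d(x, k)), and
    -- the penalty cancels the last term.
    Below-upper : ∀ x → IsUpperBound (Below x) (f origin + K * dist X (proj₁ origin) x)
    Below-upper x t (k , t≤) = ≤-trans t≤ (≤-trans
      (+-monoˡ-≤ _ (≤-trans (f[x]≤f[y]+Ld lip k origin)
        (+-mono-≤ ≤-refl (≤-trans (*-monoʳ-≤ (dist-nonNeg X _ _) L≤K)
          (*-monoˡ-≤ 0≤K (≤-trans (dist-sym X _ _) (triangle X (proj₁ origin) x (proj₁ k))))))))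
      (≤-reflexive (solve 4 (λ u K d e → (u :+ K :* (d :+ e)) :- K :* e := u :+ K :* d) refl
        (f origin) K (dist X (proj₁ origin) x) (dist X x (proj₁ k)))))

    McShane : ∀ x → ∃ (IsLeastUpperBound (Below x))
    McShane x = supremum (Below x) (_ , origin , ≤-refl) (_ , Below-upper x)

    module _ (g : Point X → Carrier) (g-lub : ∀ x → IsLeastUpperBound (Below x) (g x)) where

      g-lower : ∀ x k → f k + - (K * dist X x (proj₁ k)) ≤ g x
      g-lower x k = proj₁ (g-lub x) _ (k , ≤-refl)

      f≤g : ∀ k → f k ≤ g (proj₁ k)
      f≤g k = ≤-trans (≤-by-difference
        (*-nonNeg 0≤K (x≤y⇒0≤y-x (dist-self X (proj₁ k))))
        (solve 3 (λ u K d → (u :- K :* d) :- u := K :* (con (+ 0) :- d)) refl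
          (f k) K (dist X (proj₁ k) (proj₁ k)))) (g-lower (proj₁ k) k)

      g≤f : ∀ k → g (proj₁ k) ≤ f k
      g≤f k = proj₂ (g-lub (proj₁ k)) (f k) (λ t (k′ , t≤) → ≤-trans t≤ (≤-by-difference
        (x≤y⇒0≤y-x (≤-trans (f[x]≤f[y]+Ld lip k′ k)
          (+-mono-≤ ≤-refl (≤-trans (*-monoʳ-≤ (dist-nonNeg X _ _) L≤K) (*-monoˡ-≤ 0≤K (dist-sym X _ _))))))
        (solve 3 (λ u v w → v :- (u :- w) := (v :+ w) :- u) refl
          (f k′) (f k) (K * dist X (proj₁ k) (proj₁ k′)))))

      g-Lipschitz : Lipschitz X g
      g-Lipschitz = lipschitz K 0≤K (λ x y → proj₂ (g-lub x) _ (λ t (k , t≤) → ≤-trans t≤ (≤-trans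
        (≤-by-difference (*-nonNeg 0≤K (x≤y⇒0≤y-x (≤-trans (triangle X y x (proj₁ k))
            (+-mono-≤ (dist-sym X y x) ≤-refl))))
          (solve 5 (λ u K d e e′ → ((u :- K :* e′) :+ K :* d) :- (u :- K :* e) := K :* ((d :+ e) :- e′))
            refl (f k) K (dist X x y) (dist X x (proj₁ k)) (dist X y (proj₁ k))))
        (+-monoˡ-≤ (K * dist X x y) (g-lower y k)))))

      -- Since h k ≤ 0, reaching k from x costs a penalty K d(x, k) ≥ h x. As f k ≤ g k ≤ g x, the
      -- number g x - h x bounds every competitor at x, so g x ≤ g x - h x.
      maximiser-inside : ∀ x → (∀ y → g y ≤ g x) → h x ≤ 0#
      maximiser-inside x maximal = ≤-by-difference
        (x≤y⇒0≤y-x (proj₂ (g-lub x) (g x + - h x) (λ t (k , t≤) → ≤-trans t≤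
          (+-mono-≤ (≤-trans (f≤g k) (maximal (proj₁ k))) (-‿anti-≤ (distance k))))))
        (solve 2 (λ u v → con (+ 0) :- v := (u :- v) :- u) refl (g x) (h x))
        where
        distance : ∀ k → h x ≤ K * dist X x (proj₁ k)
        distance (k , h[k]≤0) = ≤-trans (f[x]≤f[y]+Ld h-lip x k)
          (≤-respʳ-≈ (+-identityˡ _) (+-mono-≤ h[k]≤0 (*-monoʳ-≤ (dist-nonNeg X x k) H≤K)))

  closed-compact : ∀ {X : Space (c ⊔ ℓ₂)} {h} → Compact X → Lipschitz X h →
                   Point (X ∣ h ≤0) → Compact (X ∣ h ≤0)
  closed-compact X-compact h-lip origin lip =
    let g     = λ x → proj₁ (McShane h-lip origin lip x)
        g-lub = λ x → proj₂ (McShane h-lip origin lip x)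
        x , x-maximal = X-compact (g-Lipschitz h-lip origin lip g g-lub)
        k = x , maximiser-inside h-lip origin lip g g-lub x x-maximal
    in k , (λ k′ → ≤-trans (f≤g h-lip origin lip g g-lub k′)
             (≤-trans (x-maximal (proj₁ k′)) (g≤f h-lip origin lip g g-lub k)))

  -- Bounded Lipschitz functions

  record BoundedLipschitz (X : Space a) (f : Point X → Carrier) : Set (a ⊔ c ⊔ ℓ₂) where
    field
      isLipschitz : Lipschitz X f
      bound       : Carrier
      bounded     : ∀ x → f x within bound

  open BoundedLipschitz

  BL-∘ : ∀ {f} → BoundedLipschitz Y f → (r : Point X → Point Y) → NonExpansive X Y r → BoundedLipschitz X (f ∘ r)
  BL-∘ p r r≤ = record
    { isLipschitz = Lipschitz-∘ (isLipschitz p) r≤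
    ; bound       = bound p
    ; bounded     = λ x → bounded p (r x)
    }

  BL-const : ∀ k → BoundedLipschitz X (λ _ → k)
  BL-const {X = X} k = record
    { isLipschitz = lipschitz 0# ≤-refl (λ x y → ≤-reflexive
        (solve 2 (λ k d → k := k :+ con (+ 0) :* d) refl k (dist X x y)))
    ; bound       = abs k
    ; bounded     = λ _ → within-abs k
    }

  BL-neg : ∀ {f} → BoundedLipschitz X f → BoundedLipschitz X (λ x → - f x)
  BL-neg p = record
    { isLipschitz = Lipschitz-neg (isLipschitz p)
    ; bound       = bound p
    ; bounded     = λ x → within-neg (bounded p x)
    }

  BL-+ : ∀ {f g} → BoundedLipschitz X f → BoundedLipschitz X g → BoundedLipschitz X (λ x → f x + g x)
  BL-+ {X = X} {f} {g} p q = record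
    { isLipschitz = record
      { constant        = constant (isLipschitz p) + constant (isLipschitz q)
      ; constant-nonNeg = 0≤+ (constant-nonNeg (isLipschitz p)) (constant-nonNeg (isLipschitz q))
      ; increment       = λ x y → within-weaken
          (≤-reflexive (solve 3 (λ L M d → L :* d :+ M :* d := (L :+ M) :* d) refl _ _ (dist X x y)))
          (within-respˡ-≈
            (solve 4 (λ u v s t → (u :- v) :+ (s :- t) := (u :+ s) :- (v :+ t)) refl (f x) (f y) (g x) (g y))
            (within-+ (increment (isLipschitz p) x y) (increment (isLipschitz q) x y)))
      }
    ; bound   = bound p + bound q
    ; bounded = λ x → within-+ (bounded p x) (bounded q x)
    }

  -- f x g x - f y g y = f x (g x - g y) + g y (f x - f y), so the constant involves the bounds of
  -- both factors; this is why bounds are carried along. The given point certifies that they are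
  -- nonnegative.
  BL-* : ∀ {f g} → Point X → BoundedLipschitz X f → BoundedLipschitz X g → BoundedLipschitz X (λ x → f x * g x)
  BL-* {X = X} {f} {g} x₀ p q = record
    { isLipschitz = record
      { constant        = bound p * constant (isLipschitz q) + bound q * constant (isLipschitz p)
      ; constant-nonNeg = 0≤+ (*-nonNeg (within⇒0≤ (bounded p x₀)) (constant-nonNeg (isLipschitz q)))
                              (*-nonNeg (within⇒0≤ (bounded q x₀)) (constant-nonNeg (isLipschitz p)))
      ; increment       = λ x y → within-weaken
          (≤-reflexive (solve 5 (λ A B L M d → A :* (M :* d) :+ B :* (L :* d) := (A :* M :+ B :* L) :* d)
            refl (bound p) (bound q) _ _ (dist X x y)))
          (within-respˡ-≈
            (solve 4 (λ u v s t → u :* (s :- t) :+ t :* (u :- v) := u :* s :- v :* t) refl (f x) (f y) (g x) (g y))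
            (within-+ (within-* (bounded p x) (increment (isLipschitz q) x y))
                      (within-* (bounded q y) (increment (isLipschitz p) x y))))
      }
    ; bound   = bound p * bound q
    ; bounded = λ x → within-* (bounded p x) (bounded q x)
    }

  BL-max : ∀ {f g} → BoundedLipschitz X f → BoundedLipschitz X g → BoundedLipschitz X (λ x → max (f x) (g x))
  BL-max {X = X} {f} {g} p q = record
    { isLipschitz = lipschitz (L + M) (0≤+ 0≤L 0≤M) (λ x y → ⊔-lub
        (≤-trans (f[x]≤f[y]+Ld (isLipschitz p) x y) (+-mono-≤ (x≤x⊔y _ _) (*-monoʳ-≤ (dist-nonNeg X x y)
          (≤-respˡ-≈ (+-identityʳ L) (+-mono-≤ ≤-refl 0≤M)))))
        (≤-trans (f[x]≤f[y]+Ld (isLipschitz q) x y) (+-mono-≤ (x≤y⊔x _ _) (*-monoʳ-≤ (dist-nonNeg X x y)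
          (≤-respˡ-≈ (+-identityˡ M) (+-mono-≤ 0≤L ≤-refl))))))
    ; bound       = max (bound p) (bound q)
    ; bounded     = λ x →
        ≤-trans (-‿anti-≤ (x≤x⊔y _ _)) (≤-trans (proj₁ (bounded p x)) (x≤x⊔y _ _)) ,
        ⊔-mono-≤ (proj₂ (bounded p x)) (proj₂ (bounded q x))
    }
    where
    L = constant (isLipschitz p)
    M = constant (isLipschitz q)
    0≤L = constant-nonNeg (isLipschitz p)
    0≤M = constant-nonNeg (isLipschitz q)

  BL-sum : ∀ {n} {f : Fin n → Point X → Carrier} → (∀ i → BoundedLipschitz X (f i)) →
           BoundedLipschitz X (λ x → sum (λ i → f i x))
  BL-sum {n = zero}  p = BL-const 0#
  BL-sum {n = suc n} p = BL-+ (p zero) (BL-sum (p ∘ suc))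

  BL-maximum : ∀ {n} {f : Fin n → Point X → Carrier} → (∀ i → BoundedLipschitz X (f i)) →
               BoundedLipschitz X (λ x → maximum (λ i → f i x))
  BL-maximum {n = zero}  p = BL-const 0#
  BL-maximum {n = suc n} p = BL-max (p zero) (BL-maximum (p ∘ suc))

  BL-coordinate : BoundedLipschitz interval proj₁
  BL-coordinate = record
    { isLipschitz = lipschitz 1# 0≤1 (λ x y → ≤-respˡ-≈
        (solve 2 (λ u v → v :+ (u :- v) := u) refl (proj₁ x) (proj₁ y))
        (+-mono-≤ ≤-refl (≤-respʳ-≈ (sym (*-identityˡ _)) (proj₂ (within-abs _)))))
    ; bound       = 1#
    ; bounded     = proj₂
    }

  NonExpansive-lookup : ∀ {n} i → NonExpansive (X ^ˢ n) X (λ x → x i)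
  NonExpansive-lookup {X = X} i x y = ≤sum (λ j → dist-nonNeg X (x j) (y j)) i

  NonExpansive-proj₁ : NonExpansive (X ×ˢ Y) X proj₁
  NonExpansive-proj₁ {Y = Y} _ _ = ≤-respˡ-≈ (+-identityʳ _) (+-mono-≤ ≤-refl (dist-nonNeg Y _ _))

  NonExpansive-proj₂ : NonExpansive (X ×ˢ Y) Y proj₂
  NonExpansive-proj₂ {X = X} _ _ = ≤-respˡ-≈ (+-identityˡ _) (+-mono-≤ (dist-nonNeg X _ _) ≤-refl)

  -- Discrepancy

  ≤maximum : ∀ {n} (u : Vector Carrier n) i → u i ≤ maximum u
  ≤maximum u zero    = x≤x⊔y _ _
  ≤maximum u (suc i) = ≤-trans (≤maximum (tail u) i) (x≤y⊔x _ _)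

  maximum-least : ∀ {n} {u : Vector Carrier n} {b} → 0# ≤ b → (∀ i → u i ≤ b) → maximum u ≤ b
  maximum-least {zero}  0≤b u≤b = 0≤b
  maximum-least {suc n} 0≤b u≤b = ⊔-lub (u≤b zero) (maximum-least 0≤b (u≤b ∘ suc))

  0≤maximum : ∀ {n} (u : Vector Carrier n) → 0# ≤ maximum u
  0≤maximum {zero}  u = ≤-refl
  0≤maximum {suc n} u = ≤-trans (0≤maximum (tail u)) (x≤y⊔x _ _)

  maximum-cong : ∀ {n} {u v : Vector Carrier n} → (∀ i → u i ≈ v i) → maximum u ≈ maximum v
  maximum-cong {zero}  u≈v = refl
  maximum-cong {suc n} u≈v = ⊔-cong (u≈v zero) (maximum-cong (u≈v ∘ suc))

  -- A monotone map commutes with binary maxima, and √0 = 0 matches the initial value of the fold.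
  -- This carries extrema of `maxNormSq` over to the norm.
  √-maximum : ∀ {n} (u : Vector Carrier n) → √ maximum u ≈ maximum (λ i → √ u i)
  √-maximum {zero}  u = √0≈0
  √-maximum {suc n} u = trans (mono-≤-distrib-⊔ √-cong √-mono-≤ (u zero) (maximum (tail u)))
    (⊔-cong refl (√-maximum (tail u)))

  normSq : ℂ → Carrier
  normSq w = re w * re w + im w * im w

  0≤normSq : ∀ w → 0# ≤ normSq w
  0≤normSq w = 0≤+ (0≤x² (re w)) (0≤x² (im w))

  maxNormSq : ∀ {m} → Vector ℂ m → Carrier
  maxNormSq w = maximum (λ i → normSq (w i))

  √maxNormSq≈‖‖∞ : ∀ {m} (w : Vector ℂ m) → √ maxNormSq w ≈ ‖ w ‖∞
  √maxNormSq≈‖‖∞ w = √-maximum (λ i → normSq (w i))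

  BLᶜ : (X : Space a) → (Point X → ℂ) → Set (a ⊔ c ⊔ ℓ₂)
  BLᶜ X f = BoundedLipschitz X (λ x → re (f x)) × BoundedLipschitz X (λ x → im (f x))

  BLᶜ-* : ∀ {f g} → Point X → BLᶜ X f → BLᶜ X g → BLᶜ X (λ x → f x *ᶜ g x)
  BLᶜ-* x₀ (p , p′) (q , q′) =
    BL-+ (BL-* x₀ p q) (BL-neg (BL-* x₀ p′ q′)) , BL-+ (BL-* x₀ p q′) (BL-* x₀ p′ q)

  BLᶜ-sum : ∀ {n} {f : Fin n → Point X → ℂ} → (∀ i → BLᶜ X (f i)) → BLᶜ X (λ x → sumᶜ (λ i → f i x))
  BLᶜ-sum {n = zero}  p = BL-const 0# , BL-const 0#
  BLᶜ-sum {n = suc n} p =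
    BL-+ (proj₁ (p zero)) (proj₁ (BLᶜ-sum (p ∘ suc))) , BL-+ (proj₂ (p zero)) (proj₂ (BLᶜ-sum (p ∘ suc)))

  BL-maxNormSq : ∀ {m n} {C : Point X → Matrix ℂ m n} {z : Point X → Vector ℂ n} → Point X →
                 (∀ i j → BLᶜ X (λ x → C x i j)) → (∀ j → BLᶜ X (λ x → z x j)) →
                 BoundedLipschitz X (λ x → maxNormSq (C x ·ᶜ z x))
  BL-maxNormSq {X = X} {C = C} {z} x₀ p q = BL-maximum (λ i →
    let r , r′ = BLᶜ-sum {X = X} {f = λ j x → C x i j *ᶜ z x j} (λ j → BLᶜ-* x₀ (p i j) (q j))
    in BL-+ (BL-* x₀ r r) (BL-* x₀ r′ r′))

  -- The circle and the balls as compact spaces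

  square : Space (c ⊔ ℓ₂)
  square = interval ^ˢ 2

  toℂ : Point square → ℂ
  toℂ x = proj₁ (x zero) +i proj₁ (x (suc zero))

  fromℂ : (w : ℂ) → normSq w ≤ 1# → Point square
  fromℂ w w≤1 zero       = re w , x²≤1⇒x-within-1 (≤-trans
    (≤-respˡ-≈ (+-identityʳ _) (+-mono-≤ ≤-refl (0≤x² (im w)))) w≤1)
  fromℂ w w≤1 (suc zero) = im w , x²≤1⇒x-within-1 (≤-trans
    (≤-respˡ-≈ (+-identityˡ _) (+-mono-≤ (0≤x² (re w)) ≤-refl)) w≤1)

  BLᶜ-toℂ : BLᶜ square toℂ
  BLᶜ-toℂ = BL-∘ {X = square} BL-coordinate (λ x → x zero) (NonExpansive-lookup {X = interval} {n = 2} zero) ,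
            BL-∘ {X = square} BL-coordinate (λ x → x (suc zero)) (NonExpansive-lookup {X = interval} {n = 2} (suc zero))

  0-point : Point interval
  0-point = 0# , 0-within 0≤1

  BL-normSq : BoundedLipschitz square (λ x → normSq (toℂ x))
  BL-normSq = BL-+ (BL-* o (proj₁ BLᶜ-toℂ) (proj₁ BLᶜ-toℂ)) (BL-* o (proj₂ BLᶜ-toℂ) (proj₂ BLᶜ-toℂ))
    where
    o : Point square
    o _ = 0-point

  -- Puts the equation |z|² = 1 into the form h ≤ 0 demanded by `closed-compact`.
  normSq-excess : Point square → Carrier
  normSq-excess x = abs (normSq (toℂ x) + - 1#)

  x≤1⇒x-1≤0 : ∀ {x} → x ≤ 1# → x + - 1# ≤ 0#
  x≤1⇒x-1≤0 x≤1 = ≤-respʳ-≈ (-‿inverseʳ 1#) (+-monoˡ-≤ (- 1#) x≤1)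

  x-1≤0⇒x≤1 : ∀ {x} → x + - 1# ≤ 0# → x ≤ 1#
  x-1≤0⇒x≤1 {x} x-1≤0 = ≤-respˡ-≈ (solve 1 (λ x → (x :- con (+ 1)) :+ con (+ 1) := x) refl x)
    (≤-respʳ-≈ (+-identityˡ 1#) (+-monoˡ-≤ 1# x-1≤0))

  circle : Space (c ⊔ ℓ₂)
  circle = square ∣ normSq-excess ≤0

  abs[x-1]≤0⇒x≈1 : ∀ {x} → abs (x + - 1#) ≤ 0# → x ≈ 1#
  abs[x-1]≤0⇒x≈1 {x} h = antisym (x-1≤0⇒x≤1 (proj₂ d))
    (0≤y-x⇒x≤y (≤-respˡ-≈ -0#≈0# (proj₁ d)))
    where
    d : x + - 1# within 0#
    d = within-weaken h (within-abs (x + - 1#))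

  x≈1⇒abs[x-1]≤0 : ∀ {x} → x ≈ 1# → abs (x + - 1#) ≤ 0#
  x≈1⇒abs[x-1]≤0 x≈1 = abs-least (within-respˡ-≈
    (sym (trans (+-congʳ x≈1) (-‿inverseʳ 1#))) (0-within ≤-refl))

  circle-normSq : (p : Point circle) → normSq (toℂ (proj₁ p)) ≈ 1#
  circle-normSq p = abs[x-1]≤0⇒x≈1 {normSq (toℂ (proj₁ p))} (proj₂ p)

  circlePoint : (w : ℂ) → normSq w ≈ 1# → Point circle
  circlePoint w w≈1 = fromℂ w (≤-reflexive w≈1) , x≈1⇒abs[x-1]≤0 {normSq w} w≈1

  1-circlePoint : Point circle
  1-circlePoint = circlePoint (1# +i 0#)
    (trans (+-cong (*-identityˡ 1#) (zeroˡ 0#)) (+-identityʳ 1#))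

  square-compact : Compact square
  square-compact = ^-compact interval-compact 2

  circle-compact : Compact circle
  circle-compact = closed-compact square-compact
    (isLipschitz (BL-max excess (BL-neg excess)))
    1-circlePoint
    where
    excess : BoundedLipschitz square (λ x → normSq (toℂ x) + - 1#)
    excess = BL-+ BL-normSq (BL-const (- 1#))

  -- The possible columns of a Komlós matrix, with `q` the squared modulus of an entry. A matrix
  -- with n columns becomes a point of the n-th power.
  ball : ∀ (X : Space (c ⊔ ℓ₂)) → (Point X → Carrier) → ℕ → Space (c ⊔ ℓ₂)
  ball X q m = (X ^ˢ m) ∣ (λ x → sum (λ i → q (x i)) + - 1#) ≤0

  ball-compact : ∀ {X q} → Compact X → BoundedLipschitz X q → (o : Point X) → q o ≤ 0# →
                 ∀ m → Compact (ball X q m)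
  ball-compact {X} {q} X-compact q-BL o q[o]≤0 m = closed-compact (^-compact X-compact m)
    (isLipschitz (BL-+ (BL-sum {n = m} (λ i → BL-∘ {X = X ^ˢ m} q-BL (λ x → x i) (NonExpansive-lookup {X = X} i)))
      (BL-const (- 1#))))
    ((λ _ → o) , ≤-respʳ-≈ (-‿inverseʳ 1#)
      (+-monoˡ-≤ (- 1#) (≤-trans (sum≤0 {m} (λ _ → q[o]≤0)) 0≤1)))

  -- Attainment of the discrepancy over a compact family of matrices

  module _ {m n} {Y : Space (c ⊔ ℓ₂)} (Y-compact : Compact Y) (C : Point Y → Matrix ℂ m n)
           (C-BL : ∀ i j → BLᶜ Y (λ y → C y i j)) where

    private
      Z = circle ^ˢ n

    phases : Point Z → Vector ℂ n
    phases p j = toℂ (proj₁ (p j))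

    phases∈𝕋 : ∀ p → 𝕋 n (phases p)
    phases∈𝕋 p j = trans (√-cong (circle-normSq (p j))) √1≈1

    objective : Point (Y ×ˢ Z) → Carrier
    objective (y , p) = maxNormSq (C y ·ᶜ phases p)

    objective-Lipschitz : Point Y → Lipschitz (Y ×ˢ Z) objective
    objective-Lipschitz y₀ = isLipschitz (BL-maxNormSq {X = Y ×ˢ Z} (y₀ , λ _ → 1-circlePoint)
      (λ i j → BL-∘ {X = Y ×ˢ Z} (proj₁ (C-BL i j)) proj₁ (NonExpansive-proj₁ {X = Y} {Y = Z}) ,
               BL-∘ {X = Y ×ˢ Z} (proj₂ (C-BL i j)) proj₁ (NonExpansive-proj₁ {X = Y} {Y = Z}))
      (λ j → BL-∘ {X = Y ×ˢ Z} (proj₁ BLᶜ-toℂ) (λ w → proj₁ (proj₂ w j)) (coordinate j) ,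
             BL-∘ {X = Y ×ˢ Z} (proj₂ BLᶜ-toℂ) (λ w → proj₁ (proj₂ w j)) (coordinate j)))
      where
      coordinate : ∀ j → NonExpansive (Y ×ˢ Z) square (λ w → proj₁ (proj₂ w j))
      coordinate j w w′ = ≤-trans (NonExpansive-lookup {X = circle} j (proj₂ w) (proj₂ w′))
        (NonExpansive-proj₂ {X = Y} {Y = Z} w w′)

    module _ (r : Point Y → Point Z) (r-minimal : ∀ y p → objective (y , r y) ≤ objective (y , p)) where

      minimum-IsCdisc : ∀ y → IsCdisc (C y) (√ objective (y , r y))
      minimum-IsCdisc y =
        (phases (r y) , phases∈𝕋 (r y) , sym (√maxNormSq≈‖‖∞ (C y ·ᶜ phases (r y)))) ,
        (λ z z∈𝕋 → ≤-respʳ-≈ (√maxNormSq≈‖‖∞ (C y ·ᶜ z)) (√-mono-≤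
          (r-minimal y (λ j → circlePoint (z j) (√x≈1⇒x≈1 (0≤normSq (z j)) (z∈𝕋 j))))))

      maximum-of-minima : ∀ y* → (∀ y → objective (y , r y) ≤ objective (y* , r y*)) →
        ∃[ v ] (∃[ y ] IsCdisc (C y) v) × (∀ y → ∃[ w ] IsCdisc (C y) w × w ≤ v)
      maximum-of-minima y* y*-maximal =
        √ objective (y* , r y*) , (y* , minimum-IsCdisc y*) ,
        (λ y → √ objective (y , r y) , minimum-IsCdisc y , √-mono-≤ (y*-maximal y))

    cdisc-maximum : ∃[ v ] (∃[ y ] IsCdisc (C y) v) × (∀ y → ∃[ w ] IsCdisc (C y) w × w ≤ v)
    cdisc-maximum =
      -- Compactness in this sense includes having a point: a maximiser of a constant function is
      -- one.
      let y₀ , _ = Y-compact {λ _ → 0#} (isLipschitz (BL-const 0#))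
          r , r-minimal , y* , y*-maximal = max-min {X = Y} {Z} {objective} Y-compact
            (^-compact circle-compact n) (objective-Lipschitz y₀)
      in maximum-of-minima r r-minimal y* y*-maximal

  -- Komlós matrices as points of powers of balls

  sum-squares-nonNeg : ∀ {m} (v : Vector Carrier m) → 0# ≤ sum (λ i → v i * v i)
  sum-squares-nonNeg v = 0≤sum (λ i → 0≤x² (v i))

  sum-∣∣²≈sum-normSq : ∀ {m} (w : Vector ℂ m) → sum (λ i → ∣ w i ∣ * ∣ w i ∣) ≈ sum (λ i → normSq (w i))
  sum-∣∣²≈sum-normSq w = sum-cong-≋ (λ i → √-square (0≤normSq (w i)))

  𝒜⇒sum≤1 : ∀ {m n} {A : Matrix Carrier m n} → 𝒜 m n A → ∀ j → sum (λ i → A i j * A i j) ≤ 1#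
  𝒜⇒sum≤1 {A = A} A∈𝒜 j = √x≤1⇒x≤1 (sum-squares-nonNeg (λ i → A i j)) (A∈𝒜 j)

  𝒞⇒sum≤1 : ∀ {m n} {C : Matrix ℂ m n} → 𝒞 m n C → ∀ j → sum (λ i → normSq (C i j)) ≤ 1#
  𝒞⇒sum≤1 {C = C} C∈𝒞 j = ≤-respˡ-≈ (sum-∣∣²≈sum-normSq (λ i → C i j))
    (√x≤1⇒x≤1 (sum-squares-nonNeg (λ i → ∣ C i j ∣)) (C∈𝒞 j))

  sum≤1⇒𝒞 : ∀ {m n} {C : Matrix ℂ m n} → (∀ j → sum (λ i → normSq (C i j)) ≤ 1#) → 𝒞 m n C
  sum≤1⇒𝒞 {C = C} s j = x≤1⇒√x≤1 (≤-respˡ-≈ (sym (sum-∣∣²≈sum-normSq (λ i → C i j))) (s j))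

  fromReal : ∀ {m n} → Matrix Carrier m n → Matrix ℂ m n
  fromReal A i j = A i j +i 0#

  x²+0²≈x² : ∀ x → x * x + 0# * 0# ≈ x * x
  x²+0²≈x² x = trans (+-congˡ (zeroˡ 0#)) (+-identityʳ (x * x))

  fromReal∈𝒞 : ∀ {m n} {A : Matrix Carrier m n} → 𝒜 m n A → 𝒞 m n (fromReal A)
  fromReal∈𝒞 {A = A} A∈𝒜 = sum≤1⇒𝒞 {C = fromReal A} (λ j →
    ≤-respˡ-≈ (sum-cong-≋ (λ i → sym (x²+0²≈x² (A i j)))) (𝒜⇒sum≤1 {A = A} A∈𝒜 j))

  realBall : ℕ → Space (c ⊔ ℓ₂)
  realBall = ball interval (λ x → proj₁ x * proj₁ x)

  realBall-compact : ∀ m → Compact (realBall m)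
  realBall-compact = ball-compact interval-compact (BL-* 0-point BL-coordinate BL-coordinate)
    0-point (≤-reflexive (zeroˡ 0#))

  complexBall : ℕ → Space (c ⊔ ℓ₂)
  complexBall = ball square (λ x → normSq (toℂ x))

  complexBall-compact : ∀ m → Compact (complexBall m)
  complexBall-compact = ball-compact square-compact BL-normSq (λ _ → 0-point)
    (≤-reflexive (trans (x²+0²≈x² 0#) (zeroˡ 0#)))

  realMatrix : ∀ {m n} → Point (realBall m ^ˢ n) → Matrix Carrier m n
  realMatrix y i j = proj₁ (proj₁ (y j) i)

  realMatrix∈𝒜 : ∀ {m n} (y : Point (realBall m ^ˢ n)) → 𝒜 m n (realMatrix y)
  realMatrix∈𝒜 y j = x≤1⇒√x≤1 (x-1≤0⇒x≤1 (proj₂ (y j)))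

  fromRealMatrix : ∀ {m n} (A : Matrix Carrier m n) → 𝒜 m n A → Point (realBall m ^ˢ n)
  fromRealMatrix A A∈𝒜 j =
    (λ i → A i j , x²≤1⇒x-within-1 (≤-trans (≤sum (λ i → 0≤x² (A i j)) i) (𝒜⇒sum≤1 {A = A} A∈𝒜 j))) ,
    x≤1⇒x-1≤0 (𝒜⇒sum≤1 {A = A} A∈𝒜 j)

  complexMatrix : ∀ {m n} → Point (complexBall m ^ˢ n) → Matrix ℂ m n
  complexMatrix y i j = toℂ (proj₁ (y j) i)

  complexMatrix∈𝒞 : ∀ {m n} (y : Point (complexBall m ^ˢ n)) → 𝒞 m n (complexMatrix y)
  complexMatrix∈𝒞 y = sum≤1⇒𝒞 {C = complexMatrix y} (λ j → x-1≤0⇒x≤1 (proj₂ (y j)))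

  fromComplexMatrix : ∀ {m n} (C : Matrix ℂ m n) → 𝒞 m n C → Point (complexBall m ^ˢ n)
  fromComplexMatrix C C∈𝒞 j =
    (λ i → fromℂ (C i j) (≤-trans (≤sum (λ i → 0≤normSq (C i j)) i) (𝒞⇒sum≤1 {C = C} C∈𝒞 j))) ,
    x≤1⇒x-1≤0 (𝒞⇒sum≤1 {C = C} C∈𝒞 j)

  maxCdisc-exists : ∀ m n → ∃ (IsMaxCdisc m n)
  maxCdisc-exists m n =
    let v , (y , y-cdisc) , bound = cdisc-maximum {m} {n} {complexBall m ^ˢ n}
          (^-compact (complexBall-compact m) n) complexMatrix
          (λ i j → BL-∘ {X = complexBall m ^ˢ n} (proj₁ BLᶜ-toℂ) (λ y → proj₁ (y j) i) (entry i j) ,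
                   BL-∘ {X = complexBall m ^ˢ n} (proj₂ BLᶜ-toℂ) (λ y → proj₁ (y j) i) (entry i j))
    in v , (complexMatrix y , complexMatrix∈𝒞 y , y-cdisc) , (λ C C∈𝒞 → bound (fromComplexMatrix C C∈𝒞))
    where
    entry : ∀ i j → NonExpansive (complexBall m ^ˢ n) square (λ y → proj₁ (y j) i)
    entry i j y y′ = ≤-trans (NonExpansive-lookup {X = square} i (proj₁ (y j)) (proj₁ (y′ j)))
      (NonExpansive-lookup {X = complexBall m} j y y′)

  -- Phrased with `IsCdisc` so that `cdisc-maximum` applies to real matrices as well;
  -- `IsMaxRealCdisc⇒IsK₂` translates the result.
  maxRealCdisc-exists : ∀ m n → ∃ (IsMax (𝒜 m n) (λ A → IsCdisc (fromReal A)))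
  maxRealCdisc-exists m n =
    let v , (y , y-cdisc) , bound = cdisc-maximum {m} {n} {realBall m ^ˢ n}
          (^-compact (realBall-compact m) n) (λ y → fromReal (realMatrix y))
          (λ i j → BL-∘ {X = realBall m ^ˢ n} BL-coordinate (λ y → proj₁ (y j) i) (entry i j) , BL-const 0#)
    in v , (realMatrix y , realMatrix∈𝒜 y , y-cdisc) , (λ A A∈𝒜 → bound (fromRealMatrix A A∈𝒜))
    where
    entry : ∀ i j → NonExpansive (realBall m ^ˢ n) interval (λ y → proj₁ (y j) i)
    entry i j y y′ = ≤-trans (NonExpansive-lookup {X = interval} i (proj₁ (y j)) (proj₁ (y′ j)))
      (NonExpansive-lookup {X = realBall m} j y y′)

  -- Planar vectors as complex numbers

  planar : Vector Carrier 2 → ℂ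
  planar u = u zero +i u (suc zero)

  coordinates : ℂ → Vector Carrier 2
  coordinates w = re w ∷ im w ∷ []

  ‖u‖₂≈∣planar∣ : ∀ u → ‖ u ‖₂ ≈ ∣ planar u ∣
  ‖u‖₂≈∣planar∣ u = √-cong (+-congˡ (+-identityʳ _))

  ∣∣-cong : ∀ {w z} → re w ≈ re z → im w ≈ im z → ∣ w ∣ ≈ ∣ z ∣
  ∣∣-cong p q = √-cong (+-cong (*-cong p p) (*-cong q q))

  re-real-row : ∀ {n} (a : Vector Carrier n) (z : Vector ℂ n) →
                re (sumᶜ (λ j → (a j +i 0#) *ᶜ z j)) ≈ sum (λ j → a j * re (z j))
  re-real-row {zero}  a z = refl
  re-real-row {suc n} a z = +-cong
    (solve 3 (λ a x y → a :* x :- con (+ 0) :* y := a :* x) refl (a zero) (re (z zero)) (im (z zero)))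
    (re-real-row (tail a) (tail z))

  im-real-row : ∀ {n} (a : Vector Carrier n) (z : Vector ℂ n) →
                im (sumᶜ (λ j → (a j +i 0#) *ᶜ z j)) ≈ sum (λ j → a j * im (z j))
  im-real-row {zero}  a z = refl
  im-real-row {suc n} a z = +-cong
    (solve 3 (λ a x y → a :* y :+ con (+ 0) :* x := a :* y) refl (a zero) (re (z zero)) (im (z zero)))
    (im-real-row (tail a) (tail z))

  planar-objective : ∀ {m n} (A : Matrix Carrier m n) (u : Fin n → Vector Carrier 2) →
    maximum (λ i → ‖ (λ k → sum (λ j → A i j * u j k)) ‖₂) ≈ ‖ fromReal A ·ᶜ (λ j → planar (u j)) ‖∞
  planar-objective A u = maximum-cong (λ i → trans
    (‖u‖₂≈∣planar∣ (λ k → sum (λ j → A i j * u j k)))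
    (∣∣-cong (sym (re-real-row (A i) (λ j → planar (u j)))) (sym (im-real-row (A i) (λ j → planar (u j))))))

  IsCdisc⇒IsVdisc₂ : ∀ {m n} (A : Matrix Carrier m n) {v} → IsCdisc (fromReal A) v → IsVdisc₂ A v
  IsCdisc⇒IsVdisc₂ A ((z , z∈𝕋 , Az≈v) , v≤) =
    ( (λ j → coordinates (z j))
    , (λ j → trans (‖u‖₂≈∣planar∣ (coordinates (z j))) (z∈𝕋 j))
    , trans (planar-objective A (λ j → coordinates (z j))) Az≈v) ,
    (λ u u∈𝕊¹ → ≤-respʳ-≈ (sym (planar-objective A u))
      (v≤ (λ j → planar (u j)) (λ j → trans (sym (‖u‖₂≈∣planar∣ (u j))) (u∈𝕊¹ j))))

  IsMaxRealCdisc⇒IsK₂ : ∀ {m n v} → IsMax (𝒜 m n) (λ A → IsCdisc (fromReal A)) v → IsK₂ m n v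
  IsMaxRealCdisc⇒IsK₂ ((A , A∈𝒜 , A-cdisc) , bound) =
    (A , A∈𝒜 , IsCdisc⇒IsVdisc₂ A A-cdisc) ,
    (λ B B∈𝒜 → let w , B-cdisc , w≤v = bound B B∈𝒜 in w , IsCdisc⇒IsVdisc₂ B B-cdisc , w≤v)

  -- `IsCdisc` is a relation, so two maximum statements may supply different representatives of the
  -- value at one matrix; this compares them.
  min≤min : ∀ {x p} {X : Set x} {P : X → Set p} {f : X → Carrier} {v w} →
            IsMin P f v → IsMin P f w → v ≤ w
  min≤min (_ , v≤) ((x , Px , fx≈w) , _) = ≤-respʳ-≈ fx≈w (v≤ x Px)

  maxRealCdisc≤maxCdisc : ∀ {m n v w} → IsMax (𝒜 m n) (λ A → IsCdisc (fromReal A)) v →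
                          IsMaxCdisc m n w → v ≤ w
  maxRealCdisc≤maxCdisc ((A , A∈𝒜 , A-cdisc) , _) (_ , bound) =
    let w′ , A-cdisc′ , w′≤w = bound (fromReal A) (fromReal∈𝒞 {A = A} A∈𝒜)
    in ≤-trans (min≤min A-cdisc A-cdisc′) w′≤w

  -- Stacking real and imaginary parts

  sum-++ : ∀ {a} {A : Set a} {m n} (g : A → Carrier) (xs : Vector A m) (ys : Vector A n) →
           sum (λ i → g ((xs ++ ys) i)) ≈ sum (λ i → g (xs i)) + sum (λ i → g (ys i))
  sum-++ {m = zero}  g xs ys = sym (+-identityˡ _)
  sum-++ {m = suc m} g xs ys = trans
    (+-congˡ (trans (reflexive (sum-cong-≗ (λ i → ≡.cong g ([,]-map (splitAt m i))))) (sum-++ g (tail xs) ys)))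
    (sym (+-assoc _ _ _))

  -- The final `[]` accounts for 2 * m computing to m + (m + 0).
  stack : ∀ {m n} → Matrix ℂ m n → Matrix Carrier (2 ℕ.* m) n
  stack C = (λ i j → re (C i j)) ++ (λ i j → im (C i j)) ++ []

  -- Squared column norms are unchanged, since each entry's squared modulus splits into its two
  -- parts; no constant is lost here.
  stack∈𝒜 : ∀ {m n} {C : Matrix ℂ m n} → 𝒞 m n C → 𝒜 (2 ℕ.* m) n (stack C)
  stack∈𝒜 {C = C} C∈𝒞 j = x≤1⇒√x≤1 (≤-respˡ-≈ (sym sum-stack) (𝒞⇒sum≤1 {C = C} C∈𝒞 j))
    where
    g : Vector Carrier _ → Carrier
    g row = row j * row j
    reals = λ i j → re (C i j)
    imaginaries = λ i j → im (C i j)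
    sum-stack : sum (λ i → stack C i j * stack C i j) ≈ sum (λ i → normSq (C i j))
    sum-stack = trans (sum-++ g reals (imaginaries ++ []))
      (trans (+-congˡ (trans (sum-++ g imaginaries []) (+-identityʳ _)))
        (sym (∑-distrib-+ (λ i → g (reals i)) (λ i → g (imaginaries i)))))

  -- From (X + iY)z = Xz + i(Yz), where Xz and Yz are themselves complex: multiplication by i moves
  -- minus the imaginary part of Yz into the real part.
  re-row : ∀ {n} (c z : Vector ℂ n) → re (sumᶜ (λ j → c j *ᶜ z j)) ≈
           re (sumᶜ (λ j → (re (c j) +i 0#) *ᶜ z j)) + - im (sumᶜ (λ j → (im (c j) +i 0#) *ᶜ z j))
  re-row {zero}  c z = sym (-‿inverseʳ 0#)
  re-row {suc n} c z = trans (+-congˡ (re-row (tail c) (tail z)))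
    (solve 6 (λ a b x y s t → (a :* x :- b :* y) :+ (s :- t)
                := ((a :* x :- con (+ 0) :* y) :+ s) :- ((b :* y :+ con (+ 0) :* x) :+ t)) refl
      (re (c zero)) (im (c zero)) (re (z zero)) (im (z zero)) _ _)

  im-row : ∀ {n} (c z : Vector ℂ n) → im (sumᶜ (λ j → c j *ᶜ z j)) ≈
           im (sumᶜ (λ j → (re (c j) +i 0#) *ᶜ z j)) + re (sumᶜ (λ j → (im (c j) +i 0#) *ᶜ z j))
  im-row {zero}  c z = sym (+-identityˡ 0#)
  im-row {suc n} c z = trans (+-congˡ (im-row (tail c) (tail z)))
    (solve 6 (λ a b x y s t → (a :* y :+ b :* x) :+ (s :+ t)
                := ((a :* y :+ con (+ 0) :* x) :+ s) :+ ((b :* x :- con (+ 0) :* y) :+ t)) refl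
      (re (c zero)) (im (c zero)) (re (z zero)) (im (z zero)) _ _)

  -- For w = p + i q, by the parallelogram law.
  normSq[p+iq] : ∀ {w p q} → re w ≈ re p + - im q → im w ≈ im p + re q →
                 normSq w ≤ (normSq p + normSq q) + (normSq p + normSq q)
  normSq[p+iq] {w} {p} {q} re-w im-w = ≤-respˡ-≈ (sym (+-cong (*-cong re-w re-w) (*-cong im-w im-w)))
    (≤-by-difference (0≤+ (0≤x² (re p + im q)) (0≤x² (im p + - re q)))
      (solve 4 (λ a b x y →
        (((a :* a :+ b :* b) :+ (x :* x :+ y :* y)) :+ ((a :* a :+ b :* b) :+ (x :* x :+ y :* y)))
          :- ((a :- y) :* (a :- y) :+ (b :+ x) :* (b :+ x))
        := (a :+ y) :* (a :+ y) :+ (b :- x) :* (b :- x)) refl (re p) (im p) (re q) (im q)))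

  normSq≤ : ∀ {w b} → ∣ w ∣ ≤ b → normSq w ≤ b * b
  normSq≤ {w} {b} ∣w∣≤b = ≤-respˡ-≈ (√-square (0≤normSq w))
    (≤-trans (*-monoˡ-≤ (√-nonNeg _) ∣w∣≤b) (*-monoʳ-≤ (≤-trans (√-nonNeg _) ∣w∣≤b) ∣w∣≤b))

  ∣w∣≤ : ∀ {w b} → 0# ≤ b → normSq w ≤ b * b → ∣ w ∣ ≤ b
  ∣w∣≤ 0≤b w≤b² = ≤-trans (√-mono-≤ w≤b²) (≤-reflexive (√-square-nonNeg 0≤b))

  ‖C·z‖∞≤2‖stack‖∞ : ∀ {m n} (C : Matrix ℂ m n) (z : Vector ℂ n) →
    ‖ C ·ᶜ z ‖∞ ≤ (1# + 1#) * ‖ fromReal (stack C) ·ᶜ z ‖∞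
  ‖C·z‖∞≤2‖stack‖∞ {m} {n} C z = maximum-least 0≤2M (λ i → entry i (row-re i) (row-im i))
    where
    M = ‖ fromReal (stack C) ·ᶜ z ‖∞
    0≤2M : 0# ≤ (1# + 1#) * M
    0≤2M = *-nonNeg (0≤+ 0≤1 0≤1) (0≤maximum (λ i → ∣ (fromReal (stack C) ·ᶜ z) i ∣))
    product : Vector Carrier n → ℂ
    product row = sumᶜ (λ j → (row j +i 0#) *ᶜ z j)
    -- Stated up to an equation for the row, because the rows of X and Y are recovered from the
    -- stack by lookups in a concatenation.
    row≤ : ∀ i {row} → stack C i ≡ row → ∣ product row ∣ ≤ M
    row≤ i ≡.refl = ≤maximum (λ i → ∣ (fromReal (stack C) ·ᶜ z) i ∣) i
    reals = λ i j → re (C i j)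
    imaginaries = λ i j → im (C i j)
    row-re : ∀ i → ∣ product (reals i) ∣ ≤ M
    row-re i = row≤ (i ↑ˡ (m ℕ.+ 0)) (lookup-++ˡ reals (imaginaries ++ []) i)
    row-im : ∀ i → ∣ product (imaginaries i) ∣ ≤ M
    row-im i = row≤ (m ↑ʳ (i ↑ˡ 0)) (≡.trans (lookup-++ʳ reals (imaginaries ++ []) (i ↑ˡ 0))
      (lookup-++ˡ imaginaries [] i))
    entry : ∀ i → ∣ product (reals i) ∣ ≤ M → ∣ product (imaginaries i) ∣ ≤ M →
            ∣ (C ·ᶜ z) i ∣ ≤ (1# + 1#) * M
    entry i p≤ q≤ = ∣w∣≤ 0≤2M (≤-trans
      (normSq[p+iq] {(C ·ᶜ z) i} {product (reals i)} {product (imaginaries i)}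
        (re-row (C i) z) (im-row (C i) z))
      (≤-trans (+-mono-≤ p²+q²≤ p²+q²≤) (≤-reflexive
        (solve 1 (λ t → (t :* t :+ t :* t) :+ (t :* t :+ t :* t)
                    := ((con (+ 1) :+ con (+ 1)) :* t) :* ((con (+ 1) :+ con (+ 1)) :* t)) refl M))))
      where
      p²+q²≤ = +-mono-≤ (normSq≤ p≤) (normSq≤ q≤)

  maxCdisc≤2maxRealCdisc : ∀ {m n v w} → IsMaxCdisc m n v →
    IsMax (𝒜 (2 ℕ.* m) n) (λ A → IsCdisc (fromReal A)) w → v ≤ (1# + 1#) * w
  maxCdisc≤2maxRealCdisc ((C , C∈𝒞 , _ , v≤) , _) (_ , bound) =
    let w′ , ((z , z∈𝕋 , Az≈w′) , _) , w′≤w = bound (stack C) (stack∈𝒜 {C = C} C∈𝒞)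
    in ≤-trans (v≤ z z∈𝕋) (≤-trans (‖C·z‖∞≤2‖stack‖∞ C z)
         (*-monoˡ-≤ (0≤+ 0≤1 0≤1) (≤-trans (≤-reflexive Az≈w′) w′≤w)))

proposition1p2 : ∀ {c ℓ₁ ℓ₂} (R : CompleteOrderedField c ℓ₁ ℓ₂) →
    let open CompleteOrderedField R
        open Komlós R in
    (m n : ℕ) .{{_ : NonZero m}} .{{_ : NonZero n}} →
    ∃[ K₂⟨m,n⟩ ] ∃[ maxCdisc ] ∃[ K₂⟨2m,n⟩ ]
      IsK₂ m n K₂⟨m,n⟩ ×
      IsMaxCdisc m n maxCdisc ×
      IsK₂ (2 ℕ.* m) n K₂⟨2m,n⟩ ×
      K₂⟨m,n⟩ ≤ maxCdisc ×
      maxCdisc ≤ (1# + 1#) * K₂⟨2m,n⟩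
proposition1p2 R m n =
  let K , K-max = maxRealCdisc-exists R m n
      D , D-max = maxCdisc-exists R m n
      K′ , K′-max = maxRealCdisc-exists R (2 ℕ.* m) n
  in K , D , K′ ,
     IsMaxRealCdisc⇒IsK₂ R K-max ,
     D-max ,
     IsMaxRealCdisc⇒IsK₂ R K′-max ,
     maxRealCdisc≤maxCdisc R K-max D-max ,
     maxCdisc≤2maxRealCdisc R D-max K′-max
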